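{- Assume $\omega_a\neq0$ and $\omega_{ -b}\neq0$. Then, as formal power series in $z$ over $K$, $$\sum_{k\ge0}F_k z^k=\frac{N(z)}{D(z)},$$ where $D(z)=\det(1-z\mathbf T)$ and $N(z)$ is the $(I_0,I_0)$ cofactor of $1-z\mathbf T$ (the determinant of $1-z\mathbf T$ with row $I_0$ and column $I_0$ deleted), $I_0=[0,a-1]$. Moreover $D(z)$ has degree exactly $\binom{a+b}{a}$ and $N(z)$ has degree exactly $\binom{a+b}{a}-a-b$.
   Context: Let $S$ be a finite set of integers with $a:=\max S\ge 1$ and $b:=-\min S\ge 1$. Each $s\in S$ carries a weight $\omega_s$ in a field $K$ of characteristic $0$; set $\omega_s:=0$ for $s\in\mathbb Z\setminus S$, and for $s\in\mathbb Z$ put $\beta_s:=\delta_{s,0}-\omega_s$. For $k\ge0$, $A_k$ is the $(k+1)\times(k+1)$ matrix with rows and columns indexed by $0,\dots,k$ whose $(i,j)$ entry is $\omega_{j-i}$. Put $F_0:=1$ and $F_k:=\det(1-A_{k-1})$ for $k\ge1$. Notation: $[m,n]:=\{i\in\mathbb Z: m\le i\le n\}$, $X+c:=\{x+c:x\in X\}$; an $n$-subset is a subset of cardinality $n$. For a finite set $I\subseteq\mathbb Z$ and $s\in\mathbb Z$, $\epsilon_s(I):=(-1)^{\#\{i\in I:\ i<s\}}$. $\mathbf T$ is the square matrix with rows and columns indexed by the $a$-subsets of $[-b,a-1]$ and entries $\mathbf T[I,J]:=\epsilon_s(I)\beta_s$ if there is an integer $s$ with $I\cup\{a\}=(J+1)\cup\{s\}$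 (such $s$ is then unique), and $\mathbf T[I,J]:=0$ otherwise. -}

module Defs where

open import Algebra.Apartness.Bundles using (HeytingField; HeytingCommutativeRing)
open import Algebra.Bundles using (CommutativeRing)
open import Algebra.Bundles.Raw using (RawRing)
import Algebra.Definitions.RawSemiring as RawSemiringDefs
import Data.Bool.Properties as Bool
open import Data.Bool.Base using (if_then_else_)
open import Data.Fin.Base using (Fin; toℕ; punchIn; zero; suc)
import Data.Fin.Properties as Fin
open import Data.Fin.Subset using (Subset; inside; outside; ∣_∣; ⁅_⁆; _∪_; _∩_; ⊥; ⊤)
open import Data.Integer.Base using (ℤ; _⊖_; 0ℤ)
import Data.Integer.Base as ℤ
import Data.Integer.Properties as ℤ
open import Data.List.Base using (List; []; _∷_; [_]; filter; lookup)
import Data.List.Base as List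
open import Data.List.Membership.Propositional using (_∈_)
open import Data.List.Relation.Unary.All using (All)
open import Data.Nat.Base using (ℕ; zero; suc; _∸_; _<_)
import Data.Nat.Base as ℕ
import Data.Nat.Properties as ℕ
open import Data.Product.Base using (_×_; _,_)
open import Data.Vec.Base using (_∷ʳ_; _++_; tabulate)
import Data.Vec.Base as Vec
import Data.Vec.Properties as Vec
open import Level using (Level; _⊔_)
open import Relation.Binary.Definitions using (DecidableEquality)
open import Relation.Binary.PropositionalEquality.Core using (_≡_)
open import Relation.Nullary.Decidable using (does; yes; no; ¬?)

-- A finite set of integers is given by a list of its elements; order and
-- repetitions play no role.
IsMaxOf : ℤ → List ℤ → Set
IsMaxOf m S = m ∈ S × All (ℤ._≤ m) S

IsMinOf : ℤ → List ℤ → Set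
IsMinOf m S = m ∈ S × All (m ℤ.≤_) S

module Matrices {c ℓ} (R : RawRing c ℓ) where
  open RawRing R
  open RawSemiringDefs rawSemiring using (sum; _^_)

  infixl 6 _-ᴹ_

  Matrix : ∀ {i} → Set i → Set (c ⊔ i)
  Matrix I = I → I → Carrier

  δ : ∀ {i} {I : Set i} → DecidableEquality I → Matrix I
  δ _≟_ i j = if does (i ≟ j) then 1# else 0#

  _-ᴹ_ : ∀ {i} {I : Set i} → Matrix I → Matrix I → Matrix I
  (M -ᴹ N) i j = M i j + - N i j

  -- Laplace expansion along the first row.
  det : ∀ {n} → Matrix (Fin n) → Carrier
  det {zero}  M = 1#
  det {suc n} M = sum λ j →
    ((- 1#) ^ toℕ j) * (M zero j * det (λ r c → M (suc r) (punchIn j c)))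

  -- Determinant of the submatrix of M whose rows and columns are both
  -- indexed by a duplicate-free list; its order is immaterial, since
  -- rows and columns are permuted simultaneously.
  detOver : ∀ {i} {I : Set i} → List I → Matrix I → Carrier
  detOver is M = det (λ r c → M (lookup is r) (lookup is c))

-- Formal power series, as coefficient sequences.
module PowerSeries {c ℓ} (R : RawRing c ℓ) where
  open RawRing R
  open RawSemiringDefs rawSemiring using (sum)

  const : Carrier → (ℕ → Carrier)
  const x zero    = x
  const x (suc n) = 0#

  var : ℕ → Carrier
  var 1 = 1#
  var _ = 0#

  rawRing : RawRing c ℓ
  rawRing = record
    { Carrier = ℕ → Carrier
    ; _≈_     = λ f g → ∀ n → f n ≈ g n
    ; _+_     = λ f g n → f n + g n
    ; _*_     = λ f g n → sum {suc n} λ i → f (toℕ i) * g (n ∸ toℕ i)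
    ; -_      = λ f n → - f n
    ; 0#      = const 0#
    ; 1#      = const 1#
    }

_≟ˢ_ : ∀ {n} → DecidableEquality (Subset n)
_≟ˢ_ = Vec.≡-dec Bool._≟_

allSubsets : ∀ n → List (Subset n)
allSubsets zero    = [ Vec.[] ]
allSubsets (suc n) =
  List.map (outside Vec.∷_) (allSubsets n) List.++ List.map (inside Vec.∷_) (allSubsets n)

subsetsOfSize : ∀ n → ℕ → List (Subset n)
subsetsOfSize n k = filter (λ I → ∣ I ∣ ℕ.≟ k) (allSubsets n)

module _ {c ℓ₁ ℓ₂} (K : HeytingField c ℓ₁ ℓ₂) where
  private
    module K = HeytingField K

  fieldRawRing : RawRing c ℓ₁
  fieldRawRing = CommutativeRing.rawRing
    (HeytingCommutativeRing.commutativeRing K.heytingCommutativeRing)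

  CharacteristicZero : Set ℓ₁
  CharacteristicZero = ∀ n → (n · K.1#) K.≈ K.0# → n ≡ 0
    where open RawSemiringDefs (RawRing.rawSemiring fieldRawRing) renaming (_×_ to _·_)

  -- "f is a polynomial of degree exactly d".  Apartness from 0# means being
  -- invertible, which over a classical field is the same as being nonzero.
  HasDegree : (ℕ → K.Carrier) → ℕ → Set (ℓ₁ ⊔ ℓ₂)
  HasDegree f d = (f d K.# K.0#) × (∀ n → d < n → f n K.≈ K.0#)

module Weighted {c ℓ₁ ℓ₂} (K : HeytingField c ℓ₁ ℓ₂)
                (ω : ℤ → HeytingField.Carrier K) (a b : ℕ) where
  open HeytingField K using (Carrier; _+_; _*_; -_; 0#; 1#)
  open Matrices (fieldRawRing K)
  open RawSemiringDefs (RawRing.rawSemiring (fieldRawRing K)) using (_^_)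

  module K[[z]] = RawRing (PowerSeries.rawRing (fieldRawRing K))
  open PowerSeries (fieldRawRing K) using (const; var)
  private
    module Mz = Matrices (PowerSeries.rawRing (fieldRawRing K))

  β : ℤ → Carrier
  β s = δ ℤ._≟_ s 0ℤ + - ω s

  A : ∀ k → Matrix (Fin (suc k))
  A k i j = ω (toℕ j ⊖ toℕ i)

  F : ℕ → Carrier
  F zero    = 1#
  F (suc k) = det (δ Fin._≟_ -ᴹ A k)

  -- A subset of [-b, a-1] is encoded as a Subset (b + a), and a subset of
  -- [-b, a] as a Subset (suc (b + a)); in both, position i stands for the
  -- integer i - b.
  Index : Set
  Index = Subset (b ℕ.+ a)

  indices : List Index
  indices = subsetsOfSize (b ℕ.+ a) a

  value : Fin (suc (b ℕ.+ a)) → ℤ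
  value i = toℕ i ⊖ b

  I₀ : Index
  I₀ = ⊥ {b} ++ ⊤ {a}

  ε : Fin (suc (b ℕ.+ a)) → Index → Carrier
  ε s I = (- 1#) ^ ∣ I ∩ tabulate (λ i → does (toℕ i ℕ.<? toℕ s)) ∣

  I∪⟨a⟩ : Index → Subset (suc (b ℕ.+ a))
  I∪⟨a⟩ I = I ∷ʳ inside

  _+1 : Index → Subset (suc (b ℕ.+ a))
  J +1 = outside Vec.∷ J

  -- Any integer s with I ∪ {a} = (J + 1) ∪ {s} lies in [-b, a], so it is
  -- enough to search there.  It is unique when I and J both have a elements,
  -- the only case that occurs.
  T : Matrix Index
  T I J with Fin.any? (λ s → I∪⟨a⟩ I ≟ˢ ((J +1) ∪ ⁅ s ⁆))
  ... | yes (s , _) = ε s I * β (value s)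
  ... | no  _       = 0#

  1-zT : Mz.Matrix Index
  1-zT = Mz.δ _≟ˢ_ Mz.-ᴹ λ I J → var K[[z]].* const (T I J)

  D : K[[z]].Carrier
  D = Mz.detOver indices 1-zT

  -- The cofactor sign at a diagonal position is +1.
  N : K[[z]].Carrier
  N = Mz.detOver (filter (λ I → ¬? (I ≟ˢ I₀)) indices) 1-zT

{-# OPTIONS --safe #-}
-- Expanding det (1 - A) along its first rows, the state of the expansion is the set of
-- columns still available among the first a + b; one step acts on states by T, so F k is
-- the (I₀, I₀) entry of T ^ k. Hence the vector y with entries Σ (T ^ k)[I, I₀] z ^ k solves
-- (1 - zT) y = e, with e the unit vector at I₀. The cofactors C of the row I₀ satisfy
-- (1 - zT) C = D e, so C = D y, and the entry at I₀ reads N = D F.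
--
-- The coefficients of det (z - T) and of its cofactor are those of D and N reversed. Up to a
-- rotation of the subsets T is block triangular with invertible diagonal entries, so the
-- constant term of det (z - T) is invertible, which is the degree of D. The lowest term of
-- the reversed cofactor is read off T⁻¹: returning from I₀ to I₀ by steps of T⁻¹ takes at
-- least a + b steps, and exactly one path of that length does it.
module Submission where

open import Defs
open import Algebra.Apartness.Bundles using (HeytingField; HeytingCommutativeRing)
import Algebra.Apartness.Properties.HeytingCommutativeRing as HeytingProperties
open import Algebra.Bundles using (CommutativeRing)
open import Algebra.Bundles.Raw using (RawRing)
open import Algebra.Definitions using (Invertible)
import Algebra.Definitions.RawSemiring as RawSemiringDefs
import Algebra.Properties.CommutativeSemigroup as CommutativeSemigroupProperties
import Algebra.Properties.Ring as RingProperties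
import Algebra.Properties.Semiring.Sum as SemiringSum
open import Data.Bool.Base using (Bool; true; false; not; if_then_else_)
open import Data.Fin.Base using (Fin; toℕ; punchIn; punchOut; zero; suc)
import Data.Fin.Properties as Fin
open import Data.Fin.Subset using (Subset; inside; outside; ∣_∣; ⁅_⁆; _∪_; _∩_; ⊥; ⊤)
import Data.Fin.Subset.Properties as Subset
open import Data.Integer.Base using (ℤ; +_; _⊖_; 0ℤ)
import Data.Integer.Base as ℤ
import Data.Integer.Properties as ℤ
open import Data.List.Base using (List; []; _∷_; _++_; length; map; filter; lookup; replicate; initLast; _∷ʳ′_)
open import Data.List.Membership.Propositional using (_∈_; _∉_)
import Data.List.Membership.Propositional.Properties as ∈
import Data.List.Properties as List
open import Data.List.Relation.Unary.All using ([]; _∷_)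
import Data.List.Relation.Unary.All as All
open import Data.List.Relation.Unary.AllPairs using ([]; _∷_)
open import Data.List.Relation.Unary.Any using (here; index)
import Data.List.Relation.Unary.Any.Properties as Any
open import Data.List.Relation.Unary.Unique.Propositional using (Unique)
import Data.List.Relation.Unary.Unique.Propositional.Properties as Unique
open import Data.Nat.Base using (ℕ; zero; suc; z≤n; s≤s)
import Data.Nat.Base as ℕ
open import Data.Nat.Combinatorics using (_C_; nCk+nC[k+1]≡[n+1]C[k+1])
import Data.Nat.Properties as ℕ
open import Data.Product.Base using (Σ; _×_; _,_; ∃; proj₁; proj₂)
open import Data.Sum.Base using (_⊎_; inj₁; inj₂)
import Data.Vec.Base as Vec
import Data.Vec.Properties as Vec
open import Function.Base using (_∘_)
open import Function.Definitions using (Injective)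
open import Relation.Binary.PropositionalEquality using (module ≡-Reasoning)
open import Relation.Binary.PropositionalEquality.Core as ≡ using (_≡_; _≢_; _≗_)
import Relation.Binary.Reasoning.Setoid as SetoidReasoning
open import Relation.Nullary.Decidable using (does; yes; no; ¬?; dec-true; dec-false)
open import Relation.Nullary.Negation using (contradiction)
open import Relation.Unary using (Pred; Decidable)

-- The signs of a Laplace expansion and those of `T` have one source, the deletion of an element
-- from a set: `T` adjoins `a`, contracts against the weights `β` as in an exterior algebra, and
-- lowers every element by 1. `contract` is this common operation. The obstacle is that a state
-- always looks at a window of `a + b` columns, which runs past the last column of the finite matrix
-- near the end of the expansion. So `a` padding columns are appended, and the terminal condition at
-- `I₀` kills every expansion that uses one of them. The degree of `N` is a difference: the reversed
-- cofactor is a determinant of size `C(a+b, a) - 1`, and its lowest term sits at `z ^ (a + b - 1)`,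
-- since its coefficient at `z ^ k` already involves `k + 1` steps of the inverse of `T`. Apartness
-- from zero means invertibility and cannot be decided, so each coefficient is followed through
-- cancellations of `β` at `-b` and at `a`; the inverse of `T` is never formed.

-- Determinants by first-row expansion: alternation and cofactors.

module Determinants {c ℓ} (R : CommutativeRing c ℓ) where
  open CommutativeRing R hiding (zero)
  open Matrices rawRing
  open RawSemiringDefs (RawRing.rawSemiring rawRing) using (_^_)
  open SemiringSum semiring
  open RingProperties ring
  open SetoidReasoning setoid
  open CommutativeSemigroupProperties *-commutativeSemigroup
    using (x∙yz≈y∙xz)

  sign : ℕ → Carrier
  sign n = (- 1#) ^ n

  sum-cong : ∀ {n} {f g : Fin n → Carrier} → (∀ i → f i ≈ g i) → sum f ≈ sum g
  sum-cong f≈g = sum-cong-≋ f≈g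

  sum-zero : ∀ {n} {f : Fin n → Carrier} → (∀ i → f i ≈ 0#) → sum f ≈ 0#
  sum-zero {n} f≈0 = trans (sum-cong f≈0) (sum-replicate-zero n)

  sum-neg : ∀ {n} (f : Fin n → Carrier) → sum (λ i → - f i) ≈ - sum f
  sum-neg f = begin
    sum (λ i → - f i)        ≈⟨ sum-cong (λ i → -1*x≈-x (f i)) ⟨
    sum (λ i → - 1# * f i)   ≈⟨ *-distribˡ-sum (- 1#) f ⟨
    - 1# * sum f             ≈⟨ -1*x≈-x _ ⟩
    - sum f                  ∎

  *-zeroʳ : ∀ x {y} → y ≈ 0# → x * y ≈ 0#
  *-zeroʳ x y≈0 = trans (*-congˡ y≈0) (zeroʳ x)

  *-zeroˡ : ∀ {x} y → x ≈ 0# → x * y ≈ 0#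
  *-zeroˡ y x≈0 = trans (*-congʳ x≈0) (zeroˡ y)

  sign-suc : ∀ n x → sign (suc n) * x ≈ - (sign n * x)
  sign-suc n x = trans (*-assoc _ _ _) (-1*x≈-x _)

  det-cong : ∀ {n} {M N : Matrix (Fin n)} → (∀ r c → M r c ≈ N r c) → det M ≈ det N
  det-cong {zero}  M≈N = refl
  det-cong {suc n} M≈N = sum-cong λ j →
    *-congˡ {sign (toℕ j)} (*-cong (M≈N zero j) (det-cong λ r c → M≈N (suc r) (punchIn j c)))

  det-zeroRow : ∀ {n} (M : Matrix (Fin n)) k → (∀ c → M k c ≈ 0#) → det M ≈ 0#
  det-zeroRow {suc n} M zero    Mk≈0 = sum-zero {suc n} λ j →
    *-zeroʳ (sign (toℕ j)) (*-zeroˡ (det (λ r c → M (suc r) (punchIn j c))) (Mk≈0 j))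
  det-zeroRow {suc n} M (suc k) Mk≈0 = sum-zero {suc n} λ j →
    *-zeroʳ (sign (toℕ j)) (*-zeroʳ (M zero j)
      (det-zeroRow (λ r c → M (suc r) (punchIn j c)) k λ c → Mk≈0 (punchIn j c)))

  det-zeroColumn : ∀ {n} (M : Matrix (Fin (suc n))) → (∀ r → M r zero ≈ 0#) → det M ≈ 0#
  det-zeroColumn {n} M M0≈0 = sum-zero (term≈0 n M M0≈0)
    where
    term≈0 : ∀ n (M : Matrix (Fin (suc n))) → (∀ r → M r zero ≈ 0#) → ∀ j →
      sign (toℕ j) * (M zero j * det (λ r c → M (suc r) (punchIn j c))) ≈ 0#
    term≈0 n       M M0≈0 zero    = *-zeroʳ 1# (*-zeroˡ (det (λ r c → M (suc r) (suc c))) (M0≈0 zero))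
    term≈0 (suc n) M M0≈0 (suc j) =
      *-zeroʳ (sign (suc (toℕ j))) (*-zeroʳ (M zero (suc j))
        (det-zeroColumn (λ r c → M (suc r) (punchIn (suc j) c)) (λ r → M0≈0 (suc r))))

  -- The Laplace expansion along two rows u and v; Φ stands for the
  -- complementary minors, as a function of the remaining columns.
  laplace₂ : ∀ {n} (u v : Fin (suc (suc n)) → Carrier) →
             ((Fin n → Fin (suc (suc n))) → Carrier) → Carrier
  laplace₂ u v Φ = sum λ j → sign (toℕ j) * (u j * sum λ k →
    sign (toℕ k) * (v (punchIn j k) * Φ (punchIn j ∘ punchIn k)))

  -- Column selections are compared only pointwise, so a complementary minor has to be known to
  -- respect pointwise equality.
  Extensional : ∀ {m n} → ((Fin m → Fin n) → Carrier) → Set ℓ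
  Extensional Φ = ∀ {f g} → f ≗ g → Φ f ≈ Φ g

  private
    firstColumn : ∀ {n} → (Fin (suc n) → Carrier) →
                  ((Fin n → Fin (suc (suc n))) → Carrier) → Carrier
    firstColumn w Φ = sum λ k → sign (toℕ k) * (w k * Φ (suc ∘ punchIn k))

    rest : ∀ {n} (u v : Fin (suc (suc n)) → Carrier) →
           ((Fin n → Fin (suc (suc n))) → Carrier) → Carrier
    rest {n} u v Φ = sum {suc n} λ j → sign (toℕ j) * (u (suc j) * sum {n} λ k →
      sign (toℕ k) * (v (suc (punchIn j k)) * Φ (punchIn (suc j) ∘ punchIn (suc k))))

    -- Pairs of columns are sorted by whether `u` takes column zero, `v` takes it, or neither does.
    -- When `v` takes it, the column of `u` lies to the right, which costs one sign; hence the first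
    -- two groups are antisymmetric in `u` and `v`.
    laplace₂-split : ∀ {n} (u v : Fin (suc (suc n)) → Carrier) Φ →
      laplace₂ u v Φ ≈
      (u zero * firstColumn (v ∘ suc) Φ - v zero * firstColumn (u ∘ suc) Φ) + rest u v Φ
    laplace₂-split {n} u v Φ = begin
      1# * (u zero * P v) + sum (λ j → sign (suc (toℕ j)) * (u (suc j) * inner j))
        ≈⟨ +-cong (*-identityˡ _) (sum-cong step) ⟩
      u zero * P v + sum (λ j → first j + other j)
        ≈⟨ +-congˡ (∑-distrib-+ first other) ⟩
      u zero * P v + (sum first + sum other)
        ≈⟨ +-assoc _ _ _ ⟨
      (u zero * P v + sum first) + rest u v Φ
        ≈⟨ +-congʳ (+-congˡ firsts) ⟩
      (u zero * P v - v zero * P u) + rest u v Φ ∎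
      where
      P : (Fin (suc (suc n)) → Carrier) → Carrier
      P w = firstColumn (w ∘ suc) Φ

      φ : Fin (suc n) → Carrier
      φ j = Φ (suc ∘ punchIn j)

      tails : Fin (suc n) → Carrier
      tails j = sum {n} λ k → sign (toℕ k) * (v (suc (punchIn j k)) * Φ (punchIn (suc j) ∘ punchIn (suc k)))

      inner first other : Fin (suc n) → Carrier
      inner j = sum {suc n} λ k → sign (toℕ k) * (v (punchIn (suc j) k) * Φ (punchIn (suc j) ∘ punchIn k))
      first j = - (v zero * (sign (toℕ j) * (u (suc j) * φ j)))
      other j = sign (toℕ j) * (u (suc j) * tails j)

      inner-split : ∀ j → inner j ≈ v zero * φ j - tails j
      inner-split j = +-cong (*-identityˡ _)
        (trans (sum-cong {n} λ k → sign-suc (toℕ k) _) (sum-neg {n} λ k →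
          sign (toℕ k) * (v (suc (punchIn j k)) * Φ (punchIn (suc j) ∘ punchIn (suc k)))))

      step : ∀ j → sign (suc (toℕ j)) * (u (suc j) * inner j) ≈ first j + other j
      step j = begin
        sign (suc (toℕ j)) * (u (suc j) * inner j)
          ≈⟨ sign-suc (toℕ j) _ ⟩
        - (s * (x * inner j))
          ≈⟨ -‿cong (*-congˡ (trans (*-congˡ (inner-split j)) (x[y-z]≈xy-xz _ _ _))) ⟩
        - (s * (x * (v zero * φ j) - x * tails j))
          ≈⟨ -‿cong (x[y-z]≈xy-xz _ _ _) ⟩
        - (s * (x * (v zero * φ j)) - s * (x * tails j))
          ≈⟨ -‿+-comm _ _ ⟨
        - (s * (x * (v zero * φ j))) + - - other j
          ≈⟨ +-cong (-‿cong (trans (*-congˡ (x∙yz≈y∙xz _ _ _)) (x∙yz≈y∙xz _ _ _))) (-‿involutive _) ⟩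
        first j + other j ∎
        where
        s = sign (toℕ j)
        x = u (suc j)

      firsts : sum first ≈ - (v zero * P u)
      firsts = trans
        (sum-neg {suc n} λ j → v zero * (sign (toℕ j) * (u (suc j) * φ j)))
        (-‿cong (sym (*-distribˡ-sum {suc n} (v zero) λ j → sign (toℕ j) * (u (suc j) * φ j))))

  private
    lift₀ : ∀ {m n} → (Fin m → Fin n) → Fin (suc m) → Fin (suc n)
    lift₀ f zero    = zero
    lift₀ f (suc c) = suc (f c)

    lift₀-cong : ∀ {m n} {f g : Fin m → Fin n} → f ≗ g → lift₀ f ≗ lift₀ g
    lift₀-cong f≗g zero    = ≡.refl
    lift₀-cong f≗g (suc c) = ≡.cong suc (f≗g c)

    punchIn-lift : ∀ {n} (j : Fin (suc (suc n))) (k : Fin (suc n)) →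
      punchIn (suc j) ∘ punchIn (suc k) ≗ lift₀ (punchIn j ∘ punchIn k)
    punchIn-lift j k zero    = ≡.refl
    punchIn-lift j k (suc c) = ≡.refl

    -- Pairs avoiding column zero form a double expansion on one column fewer, column zero being
    -- returned to every complementary minor by `lift₀`. This is what allows induction on the width.
    rest-suc : ∀ {n} (u v : Fin (suc (suc (suc n))) → Carrier) Φ → Extensional Φ →
      rest u v Φ ≈ laplace₂ (u ∘ suc) (v ∘ suc) (Φ ∘ lift₀)
    rest-suc u v Φ ext = sum-cong λ j → *-congˡ {sign (toℕ j)} (*-congˡ {u (suc j)} (sum-cong λ k →
      *-congˡ {sign (toℕ k)} (*-congˡ {v (suc (punchIn j k))} (ext (punchIn-lift j k)))))

    rest-zero : ∀ (u v : Fin 2 → Carrier) Φ → rest u v Φ ≈ 0#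
    rest-zero u v Φ = sum-zero λ j →
      trans (*-congˡ {sign (toℕ j)} (zeroʳ (u (suc j)))) (zeroʳ _)

  laplace₂-alternating : ∀ {n} (u : Fin (suc (suc n)) → Carrier) Φ → Extensional Φ →
    laplace₂ u u Φ ≈ 0#
  laplace₂-alternating {n} u Φ ext = begin
    laplace₂ u u Φ                 ≈⟨ laplace₂-split u u Φ ⟩
    (u zero * P - u zero * P) + rest u u Φ ≈⟨ +-cong (-‿inverseʳ _) (rest≈0 n u Φ ext) ⟩
    0# + 0#                        ≈⟨ +-identityˡ 0# ⟩
    0#                             ∎
    where
    P = firstColumn (u ∘ suc) Φ
    rest≈0 : ∀ n (u : Fin (suc (suc n)) → Carrier) Φ → Extensional Φ → rest u u Φ ≈ 0#
    rest≈0 zero    u Φ ext = rest-zero u u Φ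
    rest≈0 (suc n) u Φ ext = trans (rest-suc u u Φ ext)
      (laplace₂-alternating (u ∘ suc) (Φ ∘ lift₀) (ext ∘ lift₀-cong))

  laplace₂-swap : ∀ {n} (u v : Fin (suc (suc n)) → Carrier) Φ → Extensional Φ →
    laplace₂ u v Φ ≈ - laplace₂ v u Φ
  laplace₂-swap {n} u v Φ ext = begin
    laplace₂ u v Φ                         ≈⟨ laplace₂-split u v Φ ⟩
    (p - q) + rest u v Φ                   ≈⟨ +-cong (+-congʳ (sym (-‿involutive p))) (rest-swap n u v Φ ext) ⟩
    (- - p - q) + - rest v u Φ             ≈⟨ +-congʳ (-‿+-comm _ _) ⟩
    - (- p + q) + - rest v u Φ             ≈⟨ +-congʳ (-‿cong (+-comm _ _)) ⟩
    - (q - p) + - rest v u Φ               ≈⟨ -‿+-comm _ _ ⟩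
    - ((q - p) + rest v u Φ)               ≈⟨ -‿cong (laplace₂-split v u Φ) ⟨
    - laplace₂ v u Φ                       ∎
    where
    p = u zero * firstColumn (v ∘ suc) Φ
    q = v zero * firstColumn (u ∘ suc) Φ
    rest-swap : ∀ n (u v : Fin (suc (suc n)) → Carrier) Φ → Extensional Φ →
                rest u v Φ ≈ - rest v u Φ
    rest-swap zero    u v Φ ext = begin
      rest u v Φ    ≈⟨ rest-zero u v Φ ⟩
      0#            ≈⟨ -0#≈0# ⟨
      - 0#          ≈⟨ -‿cong (rest-zero v u Φ) ⟨
      - rest v u Φ  ∎
    rest-swap (suc n) u v Φ ext = begin
      rest u v Φ    ≈⟨ rest-suc u v Φ ext ⟩
      laplace₂ (u ∘ suc) (v ∘ suc) (Φ ∘ lift₀)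
                    ≈⟨ laplace₂-swap (u ∘ suc) (v ∘ suc) (Φ ∘ lift₀) (ext ∘ lift₀-cong) ⟩
      - laplace₂ (v ∘ suc) (u ∘ suc) (Φ ∘ lift₀)
                    ≈⟨ -‿cong (rest-suc v u Φ ext) ⟨
      - rest v u Φ  ∎

  minor : ∀ {n} → Matrix (Fin (suc n)) → Fin (suc n) → Matrix (Fin n)
  minor M j r c = M (suc r) (punchIn j c)

  cofactor : ∀ {n} → Matrix (Fin (suc n)) → Fin (suc n) → Carrier
  cofactor M j = sign (toℕ j) * det (minor M j)

  withFirstRow : ∀ {n} → Matrix (Fin (suc n)) → (Fin (suc n) → Carrier) → Carrier
  withFirstRow M v = sum λ j → sign (toℕ j) * (v j * det (minor M j))

  -- If the second row is repeated, the double expansion alternates. A lower repeated row is first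
  -- exchanged with the second one; it then recurs inside every minor, where induction applies.
  withFirstRow-repeated : ∀ {n} (M : Matrix (Fin (suc n))) i → withFirstRow M (M (suc i)) ≈ 0#
  withFirstRow-repeated {suc n} M zero = laplace₂-alternating (M (suc zero))
    (λ g → det λ r c → M (suc (suc r)) (g c))
    (λ f≗g → det-cong λ r c → reflexive (≡.cong (M (suc (suc r))) (f≗g c)))
  withFirstRow-repeated {suc n} M (suc i) = begin
    laplace₂ v (M (suc zero)) Φ
      ≈⟨ laplace₂-swap v (M (suc zero)) Φ
           (λ f≗g → det-cong λ r c → reflexive (≡.cong (M (suc (suc r))) (f≗g c))) ⟩
    - laplace₂ (M (suc zero)) v Φ
      ≈⟨ -‿cong (sum-zero {suc (suc n)} λ j → *-zeroʳ (sign (toℕ j))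
           (*-zeroʳ (M (suc zero) j) (withFirstRow-repeated (minor M j) i))) ⟩
    - 0# ≈⟨ -0#≈0# ⟩
    0#   ∎
    where
    v = M (suc (suc i))
    Φ : (Fin n → Fin (suc (suc n))) → Carrier
    Φ g = det λ r c → M (suc (suc r)) (g c)

  row∙cofactor : ∀ {n} (M : Matrix (Fin (suc n))) v →
    sum (λ j → v j * cofactor M j) ≈ withFirstRow M v
  row∙cofactor M v = sum-cong λ j → x∙yz≈y∙xz (v j) (sign (toℕ j)) (det (minor M j))

  -- Together with `otherRow∙cofactor`: the matrix sends its column of first-row cofactors to
  -- `det M` times the first unit vector.
  firstRow∙cofactor : ∀ {n} (M : Matrix (Fin (suc n))) →
    sum (λ j → M zero j * cofactor M j) ≈ det M
  firstRow∙cofactor M = row∙cofactor M (M zero)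

  otherRow∙cofactor : ∀ {n} (M : Matrix (Fin (suc n))) i →
    sum (λ j → M (suc i) j * cofactor M j) ≈ 0#
  otherRow∙cofactor M i = trans (row∙cofactor M (M (suc i))) (withFirstRow-repeated M i)

-- The ring of formal power series, and reversal of polynomial coefficients.

module FormalPowerSeries {c ℓ} (R : CommutativeRing c ℓ) where
  open CommutativeRing R hiding (zero)
  open SemiringSum semiring
  open RingProperties ring
  open SetoidReasoning setoid
  private
    module +-CS = CommutativeSemigroupProperties +-commutativeSemigroup
  open Determinants R using (sum-cong; sum-zero; *-zeroˡ; *-zeroʳ)
  open PowerSeries rawRing using (const)

  Series : Set c
  Series = ℕ → Carrier

  module S = RawRing (PowerSeries.rawRing rawRing)

  tail : Series → Series
  tail f n = f (suc n)

  scale : Carrier → Series → Series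
  scale x f n = x * f n

  private
    *-cong-S : ∀ {f f′ g g′} → f S.≈ f′ → g S.≈ g′ → (f S.* g) S.≈ (f′ S.* g′)
    *-cong-S f≈ g≈ n = sum-cong {suc n} λ i → *-cong (f≈ (toℕ i)) (g≈ (n ℕ.∸ toℕ i))

    distribʳ-S : ∀ h f g → ((f S.+ g) S.* h) S.≈ ((f S.* h) S.+ (g S.* h))
    distribʳ-S h f g n = trans
      (sum-cong {suc n} λ i → distribʳ (h (n ℕ.∸ toℕ i)) (f (toℕ i)) (g (toℕ i)))
      (∑-distrib-+ {suc n} (λ i → f (toℕ i) * h (n ℕ.∸ toℕ i)) (λ i → g (toℕ i) * h (n ℕ.∸ toℕ i)))

  scale-* : ∀ x f g → (scale x f S.* g) S.≈ scale x (f S.* g)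
  scale-* x f g n = trans
    (sum-cong {suc n} λ i → *-assoc x (f (toℕ i)) (g (n ℕ.∸ toℕ i)))
    (sym (*-distribˡ-sum {suc n} x λ i → f (toℕ i) * g (n ℕ.∸ toℕ i)))

  -- The mirror image of (f * g) (suc n) = f 0 * g (suc n) + (tail f * g) n, which
  -- holds definitionally.
  *-suc : ∀ f g n → (f S.* g) (suc n) ≈ f (suc n) * g 0 + (f S.* tail g) n
  *-suc f g zero = begin
    f 0 * g 1 + (f 1 * g 0 + 0#)   ≈⟨ +-CS.x∙yz≈y∙xz _ _ _ ⟩
    f 1 * g 0 + (f 0 * g 1 + 0#)   ∎
  *-suc f g (suc n) = begin
    f 0 * g (suc (suc n)) + (tail f S.* g) (suc n)
      ≈⟨ +-congˡ (*-suc (tail f) g n) ⟩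
    f 0 * g (suc (suc n)) + (f (suc (suc n)) * g 0 + (tail f S.* tail g) n)
      ≈⟨ +-CS.x∙yz≈y∙xz _ _ _ ⟩
    f (suc (suc n)) * g 0 + (f 0 * g (suc (suc n)) + (tail f S.* tail g) n) ∎

  private
    *-comm-S : ∀ f g → (f S.* g) S.≈ (g S.* f)
    *-comm-S f g zero    = +-congʳ (*-comm (f 0) (g 0))
    *-comm-S f g (suc n) = begin
      f 0 * g (suc n) + (tail f S.* g) n   ≈⟨ +-cong (*-comm _ _) (*-comm-S (tail f) g n) ⟩
      g (suc n) * f 0 + (g S.* tail f) n   ≈⟨ *-suc g f n ⟨
      (g S.* f) (suc n)                    ∎

    *-assoc-S : ∀ f g h → ((f S.* g) S.* h) S.≈ (f S.* (g S.* h))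
    *-assoc-S f g h zero = +-congʳ (begin
      (f 0 * g 0 + 0#) * h 0   ≈⟨ *-congʳ (+-identityʳ _) ⟩
      f 0 * g 0 * h 0          ≈⟨ *-assoc _ _ _ ⟩
      f 0 * (g 0 * h 0)        ≈⟨ *-congˡ (+-identityʳ _) ⟨
      f 0 * (g 0 * h 0 + 0#)   ∎)
    *-assoc-S f g h (suc n) = begin
      (f 0 * g 0 + 0#) * h (suc n) + (tail (f S.* g) S.* h) n
        ≈⟨ +-cong (trans (*-congʳ (+-identityʳ _)) (*-assoc _ _ _))
                  (distribʳ-S h (scale (f 0) (tail g)) (tail f S.* g) n) ⟩
      f 0 * (g 0 * h (suc n)) + ((scale (f 0) (tail g) S.* h) n + ((tail f S.* g) S.* h) n)
        ≈⟨ +-congˡ (+-cong (scale-* (f 0) (tail g) h n) (*-assoc-S (tail f) g h n)) ⟩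
      f 0 * (g 0 * h (suc n)) + (f 0 * (tail g S.* h) n + (tail f S.* (g S.* h)) n)
        ≈⟨ +-assoc _ _ _ ⟨
      (f 0 * (g 0 * h (suc n)) + f 0 * (tail g S.* h) n) + (tail f S.* (g S.* h)) n
        ≈⟨ +-congʳ (distribˡ _ _ _) ⟨
      f 0 * (g S.* h) (suc n) + (tail f S.* (g S.* h)) n ∎

    zeroˡ-S : ∀ f {z} → (∀ n → z n ≈ 0#) → ∀ n → (z S.* f) n ≈ 0#
    zeroˡ-S f z≈0 n = sum-zero {suc n} λ i → *-zeroˡ (f (n ℕ.∸ toℕ i)) (z≈0 (toℕ i))

  const-* : ∀ x f → (const x S.* f) S.≈ scale x f
  const-* x f zero    = +-identityʳ _
  const-* x f (suc n) = trans (+-congˡ (zeroˡ-S f (λ _ → refl) n)) (+-identityʳ _)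

  const0 : ∀ n → S.0# n ≈ 0#
  const0 zero    = refl
  const0 (suc n) = refl

  private
    *-identityˡ-S : ∀ f → (S.1# S.* f) S.≈ f
    *-identityˡ-S f n = trans (const-* 1# f n) (*-identityˡ _)

  commutativeRing : CommutativeRing c ℓ
  commutativeRing = record
    { Carrier = Series
    ; _≈_ = S._≈_
    ; _+_ = S._+_
    ; _*_ = S._*_
    ; -_  = S.-_
    ; 0#  = S.0#
    ; 1#  = S.1#
    ; isCommutativeRing = record
      { isRing = record
        { +-isAbelianGroup = record
          { isGroup = record
            { isMonoid = record
              { isSemigroup = record
                { isMagma = record
                  { isEquivalence = record
                    { refl  = λ n → refl
                    ; sym   = λ f≈g n → sym (f≈g n)
                    ; trans = λ f≈g g≈h n → trans (f≈g n) (g≈h n)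
                    }
                  ; ∙-cong = λ f≈ g≈ n → +-cong (f≈ n) (g≈ n)
                  }
                ; assoc = λ f g h n → +-assoc (f n) (g n) (h n)
                }
              ; identity = (λ f n → trans (+-congʳ (const0 n)) (+-identityˡ (f n)))
                         , (λ f n → trans (+-congˡ (const0 n)) (+-identityʳ (f n)))
              }
            ; inverse = (λ f n → trans (-‿inverseˡ (f n)) (sym (const0 n)))
                      , (λ f n → trans (-‿inverseʳ (f n)) (sym (const0 n)))
            ; ⁻¹-cong = λ f≈g n → -‿cong (f≈g n)
            }
          ; comm = λ f g n → +-comm (f n) (g n)
          }
        ; *-cong = *-cong-S
        ; *-assoc = *-assoc-S
        ; *-identity = *-identityˡ-S
                     , (λ f n → trans (*-comm-S f S.1# n) (*-identityˡ-S f n))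
        ; distrib = (λ h f g n → trans (*-comm-S h (f S.+ g) n) (trans (distribʳ-S h f g n)
                      (+-cong (*-comm-S f h n) (*-comm-S g h n))))
                  , distribʳ-S
        }
      ; *-comm = *-comm-S
      }
    }

  module SR = CommutativeRing commutativeRing

  module _ (f : Series) (u : Carrier) (u*f₀≈1 : u * f 0 ≈ 1#) where
    private
      -- inverse≤ n agrees with 1/f up to degree n.
      inverse≤ : ℕ → Series
      inverse≤ n       zero    = u
      -- A default that `inverse` never reads: along its recursion the index stays at most the
      -- bound.
      inverse≤ zero    (suc k) = 0#
      inverse≤ (suc n) (suc k) = - (u * (tail f S.* inverse≤ n) k)

      inverse≤-stable : ∀ m n k → k ℕ.≤ m → k ℕ.≤ n → inverse≤ m k ≈ inverse≤ n k
      inverse≤-stable m       n       zero    _         _         = refl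
      inverse≤-stable (suc m) (suc n) (suc k) (s≤s k≤m) (s≤s k≤n) =
        -‿cong (*-congˡ (sum-cong {suc k} λ i → *-congˡ {f (suc (toℕ i))}
          (inverse≤-stable m n (k ℕ.∸ toℕ i)
            (ℕ.≤-trans (ℕ.m∸n≤m k (toℕ i)) k≤m) (ℕ.≤-trans (ℕ.m∸n≤m k (toℕ i)) k≤n))))

    inverse : Series
    inverse n = inverse≤ n n

    *-inverseʳ : (f S.* inverse) S.≈ S.1#
    *-inverseʳ zero    = trans (+-identityʳ _) (trans (*-comm _ _) u*f₀≈1)
    *-inverseʳ (suc n) = begin
      f 0 * - (u * (tail f S.* inverse≤ n) n) + (tail f S.* inverse) n
        ≈⟨ +-congʳ (-‿distribʳ-* _ _) ⟨
      - (f 0 * (u * (tail f S.* inverse≤ n) n)) + (tail f S.* inverse) n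
        ≈⟨ +-congʳ (-‿cong (trans (sym (*-assoc _ _ _))
             (trans (*-congʳ (trans (*-comm _ _) u*f₀≈1)) (*-identityˡ _)))) ⟩
      - (tail f S.* inverse≤ n) n + (tail f S.* inverse) n
        ≈⟨ +-congˡ (sum-cong {suc n} λ i → *-congˡ {f (suc (toℕ i))}
             (inverse≤-stable (n ℕ.∸ toℕ i) n (n ℕ.∸ toℕ i) ℕ.≤-refl (ℕ.m∸n≤m n (toℕ i)))) ⟩
      - (tail f S.* inverse≤ n) n + (tail f S.* inverse≤ n) n
        ≈⟨ -‿inverseˡ _ ⟩
      0# ∎

    invertible : Invertible S._≈_ S.1# S._*_ f
    invertible = inverse , (λ n → trans (*-comm-S inverse f n) (*-inverseʳ n)) , *-inverseʳ

  open RawSemiringDefs S.rawSemiring using () renaming (sum to Ssum; _^_ to _S^_) public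
  module Mz = Matrices (PowerSeries.rawRing rawRing)
  open Matrices rawRing

  sum-coefficient : ∀ {m} (f : Fin m → Series) n → Ssum f n ≈ sum (λ i → f i n)
  sum-coefficient {zero}  f n = const0 n
  sum-coefficient {suc m} f n = +-congˡ (sum-coefficient (f ∘ suc) n)

  sign-* : ∀ k f → (((S.- S.1#) S^ k) S.* f) S.≈ scale (Determinants.sign R k) f
  sign-* zero    f n = trans (*-identityˡ-S f n) (sym (*-identityˡ _))
  sign-* (suc k) f n = begin
    (((S.- S.1#) S.* ((S.- S.1#) S^ k)) S.* f) n
      ≈⟨ SR.*-assoc (S.- S.1#) ((S.- S.1#) S^ k) f n ⟩
    ((S.- S.1#) S.* (((S.- S.1#) S^ k) S.* f)) n
      ≈⟨ RingProperties.-1*x≈-x SR.ring (((S.- S.1#) S^ k) S.* f) n ⟩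
    - (((S.- S.1#) S^ k) S.* f) n
      ≈⟨ -‿cong (sign-* k f n) ⟩
    - (Determinants.sign R k * f n)
      ≈⟨ Determinants.sign-suc R k (f n) ⟨
    Determinants.sign R (suc k) * f n ∎

  constantTerm-det : ∀ {m} (M : Mz.Matrix (Fin m)) → Mz.det M 0 ≈ det (λ r c → M r c 0)
  constantTerm-det {zero}  M = refl
  constantTerm-det {suc m} M = trans (sum-coefficient term 0) (sum-cong {suc m} λ j →
    trans (sign-* (toℕ j) (M zero j S.* Mz.det (Mz-minor j)) 0)
      (*-congˡ (trans (+-identityʳ _) (*-congˡ (constantTerm-det (Mz-minor j))))))
    where
    Mz-minor : Fin (suc m) → Mz.Matrix (Fin m)
    Mz-minor = Determinants.minor commutativeRing M
    term : Fin (suc m) → Series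
    term j = ((S.- S.1#) S^ toℕ j) S.* (M zero j S.* Mz.det (Mz-minor j))

  linear : Carrier → Carrier → Series
  linear p q zero          = p
  linear p q (suc zero)    = q
  linear p q (suc (suc _)) = 0#

  linear-* : ∀ p q f → (linear p q S.* f) S.≈ λ where
    zero    → p * f 0
    (suc n) → p * f (suc n) + q * f n
  linear-* p q f zero    = +-identityʳ _
  linear-* p q f (suc n) = +-congˡ (trans (*-cong-S {g = f} const-q (λ _ → refl) n) (const-* q f n))
    where
    const-q : tail (linear p q) S.≈ const q
    const-q zero    = refl
    const-q (suc n) = refl

  -- This is `g = z ^ d * f (1/z)`. Here `d` is only an upper bound for the degrees: low-order zeros
  -- of one side lower the degree of the other.
  Reversal : ℕ → Series → Series → Set ℓ
  Reversal d f g = (∀ i j → i ℕ.+ j ≡ d → f i ≈ g j) × (∀ n → d ℕ.< n → f n ≈ 0#) × (∀ n → d ℕ.< n → g n ≈ 0#)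

  private
    linear-*-reversal : ∀ {d f g} p q → Reversal d f g →
      Reversal (suc d) (linear p q S.* f) (linear q p S.* g)
    linear-*-reversal {d} {f} {g} p q (f≈g , f≈0 , g≈0) =
      coefficients , vanishes p q f f≈0 , vanishes q p g g≈0
      where
      vanishes : ∀ p q h → (∀ n → d ℕ.< n → h n ≈ 0#) →
                 ∀ n → suc d ℕ.< n → (linear p q S.* h) n ≈ 0#
      vanishes p q h h≈0 (suc n) (s≤s d<n) = begin
        (linear p q S.* h) (suc n)  ≈⟨ linear-* p q h (suc n) ⟩
        p * h (suc n) + q * h n     ≈⟨ +-cong (*-zeroʳ p (h≈0 (suc n) (ℕ.m<n⇒m<1+n d<n))) (*-zeroʳ q (h≈0 n d<n)) ⟩
        0# + 0#                     ≈⟨ +-identityˡ 0# ⟩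
        0#                          ∎
      coefficients : ∀ i j → i ℕ.+ j ≡ suc d → (linear p q S.* f) i ≈ (linear q p S.* g) j
      coefficients zero    (suc j) eq = begin
        (linear p q S.* f) 0         ≈⟨ linear-* p q f 0 ⟩
        p * f 0                      ≈⟨ *-congˡ (f≈g 0 j (ℕ.suc-injective eq)) ⟩
        p * g j                      ≈⟨ +-identityˡ _ ⟨
        0# + p * g j                 ≈⟨ +-congʳ (*-zeroʳ q (g≈0 (suc j) (ℕ.≤-reflexive (≡.sym eq)))) ⟨
        q * g (suc j) + p * g j      ≈⟨ linear-* q p g (suc j) ⟨
        (linear q p S.* g) (suc j)   ∎
      coefficients (suc i) zero eq = begin
        (linear p q S.* f) (suc i)   ≈⟨ linear-* p q f (suc i) ⟩
        p * f (suc i) + q * f i      ≈⟨ +-cong (*-zeroʳ p (f≈0 (suc i) (ℕ.≤-reflexive (≡.trans (≡.sym eq) (ℕ.+-identityʳ (suc i))))))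
                                               (*-congˡ (f≈g i 0 (ℕ.suc-injective eq))) ⟩
        0# + q * g 0                 ≈⟨ +-identityˡ _ ⟩
        q * g 0                      ≈⟨ linear-* q p g 0 ⟨
        (linear q p S.* g) 0         ∎
      coefficients (suc i) (suc j) eq = begin
        (linear p q S.* f) (suc i)   ≈⟨ linear-* p q f (suc i) ⟩
        p * f (suc i) + q * f i      ≈⟨ +-comm _ _ ⟩
        q * f i + p * f (suc i)      ≈⟨ +-cong (*-congˡ (f≈g i (suc j) (ℕ.suc-injective eq)))
                                               (*-congˡ (f≈g (suc i) j (≡.trans (≡.sym (ℕ.+-suc i j)) (ℕ.suc-injective eq)))) ⟩
        q * g (suc j) + p * g j      ≈⟨ linear-* q p g (suc j) ⟨
        (linear q p S.* g) (suc j)   ∎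

    reversal-sum : ∀ {m d} (f g : Fin m → Series) → (∀ i → Reversal d (f i) (g i)) →
      Reversal d (Ssum f) (Ssum g)
    reversal-sum {m} f g rev
      = (λ i j eq → trans (sum-coefficient f i) (trans (sum-cong λ k → proj₁ (rev k) i j eq) (sym (sum-coefficient g j))))
      , (λ n d<n → trans (sum-coefficient f n) (sum-zero λ k → proj₁ (proj₂ (rev k)) n d<n))
      , (λ n d<n → trans (sum-coefficient g n) (sum-zero λ k → proj₂ (proj₂ (rev k)) n d<n))

    reversal-sign : ∀ {d f g} k → Reversal d f g →
      Reversal d (((S.- S.1#) S^ k) S.* f) (((S.- S.1#) S^ k) S.* g)
    reversal-sign {f = f} {g} k (f≈g , f≈0 , g≈0)
      = (λ i j eq → trans (sign-* k f i) (trans (*-congˡ (f≈g i j eq)) (sym (sign-* k g j))))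
      , (λ n d<n → trans (sign-* k f n) (*-zeroʳ _ (f≈0 n d<n)))
      , (λ n d<n → trans (sign-* k g n) (*-zeroʳ _ (g≈0 n d<n)))

  -- Every term takes one entry of degree at most 1 from each of the `m` rows, so substituting `1/z`
  -- and multiplying by `z ^ m` exchanges the two coefficients of each entry.
  det-reversal : ∀ {m} (P Q : Matrix (Fin m)) →
    Reversal m (Mz.det λ r c → linear (P r c) (Q r c)) (Mz.det λ r c → linear (Q r c) (P r c))
  det-reversal {zero} P Q = coefficients , vanishes , vanishes
    where
    vanishes : ∀ n → 0 ℕ.< n → S.1# n ≈ 0#
    vanishes (suc n) _ = refl
    coefficients : ∀ i j → i ℕ.+ j ≡ 0 → S.1# i ≈ S.1# j
    coefficients zero zero _ = refl
  det-reversal {suc m} P Q = reversal-sum {suc m} _ _ λ j → reversal-sign (toℕ j)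
    (linear-*-reversal (P zero j) (Q zero j)
      (det-reversal (λ r c → P (suc r) (punchIn j c)) (λ r c → Q (suc r) (punchIn j c))))

-- Determinants apart from zero over a Heyting field.

module FieldDeterminants {c ℓ₁ ℓ₂} (K : HeytingField c ℓ₁ ℓ₂) where
  open HeytingField K using (_#_; heytingCommutativeRing)
  commRing : CommutativeRing c ℓ₁
  commRing = HeytingCommutativeRing.commutativeRing heytingCommutativeRing
  open CommutativeRing commRing hiding (zero)
  open HeytingProperties heytingCommutativeRing public using (#-congʳ; x#0y#0→xy#0; 1#0; x-0≈x)
  open HeytingProperties heytingCommutativeRing using (invertibleˡ⇒#)
  open RingProperties ring
  open SemiringSum semiring
  open Determinants commRing
  open Matrices rawRing

  sum-single : ∀ {n} (f : Fin (suc n) → Carrier) i → (∀ j → j ≢ i → f j ≈ 0#) → sum f ≈ f i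
  sum-single {n} f i f≈0 = trans (sum-remove {i = i} f)
    (trans (+-congˡ (sum-zero {n} λ j → f≈0 (punchIn i j) (Fin.punchInᵢ≢i i j))) (+-identityʳ _))

  -1#0 : - 1# # 0#
  -1#0 = invertibleˡ⇒# (- 1# , trans (*-congˡ (x-0≈x (- 1#)))
    (trans (-1*x≈-x (- 1#)) (-‿involutive 1#)))

  sign#0 : ∀ n → sign n # 0#
  sign#0 zero    = 1#0
  sign#0 (suc n) = x#0y#0→xy#0 -1#0 (sign#0 n)

  *-cancel-#0 : ∀ {x y} → x # 0# → x * y ≈ 0# → y ≈ 0#
  *-cancel-#0 {x} {y} x#0 xy≈0 with HeytingField.#⇒invertible K x#0
  ... | x⁻¹ , x⁻¹x≈1 , _ = trans (sym (*-identityˡ y)) (trans (*-congʳ (sym x⁻¹x≈1))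
    (trans (*-assoc x⁻¹ _ y) (*-zeroʳ x⁻¹ (trans (*-congʳ (x-0≈x x)) xy≈0))))

  -- If `z` inverts `x * y`, then `z * x` inverts `y`.
  factor-#0 : ∀ {x y} → x * y # 0# → y # 0#
  factor-#0 {x} {y} xy#0 with HeytingField.#⇒invertible K xy#0
  ... | z , zxy≈1 , _ = invertibleˡ⇒# (z * x , trans (*-congˡ (x-0≈x y))
    (trans (*-assoc z x y) (trans (*-congˡ (sym (x-0≈x (x * y)))) zxy≈1)))

  ZeroOutside : ∀ {n} → (Fin n → Carrier) → Fin n → Set ℓ₁
  ZeroOutside v c = ∀ c′ → c′ ≢ c → v c′ ≈ 0#

  -- Along the first row only the entry at σ 0 contributes: for any other
  -- nonzero entry, the complementary minor has a zero row.
  det-#0 : ∀ {n} (M : Matrix (Fin n)) (σ : Fin n → Fin n) → Injective _≡_ _≡_ σ →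
    (∀ r → M r (σ r) # 0#) →
    (∀ r c → c ≢ σ r → M r c ≈ 0# ⊎ ∃ λ k → σ k ≡ c × ZeroOutside (M k) c) →
    det M # 0#
  det-#0 {zero}  M σ inj diag off = 1#0
  det-#0 {suc n} M σ inj diag off = #-congʳ (sym (sum-single term (σ zero) others))
    (x#0y#0→xy#0 (sign#0 (toℕ (σ zero))) (x#0y#0→xy#0 (diag zero)
      (det-#0 (minor M (σ zero)) σ′ inj′ diag′ off′)))
    where
    term : Fin (suc n) → Carrier
    term j = sign (toℕ j) * (M zero j * det (minor M j))

    others : ∀ j → j ≢ σ zero → term j ≈ 0#
    others j j≢ with off zero j j≢
    ... | inj₁ M0j≈0 = *-zeroʳ (sign (toℕ j)) (*-zeroˡ (det (minor M j)) M0j≈0)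
    ... | inj₂ (zero  , σ0≡j , _) = contradiction (≡.sym σ0≡j) j≢
    ... | inj₂ (suc k , _ , Mk≈0) = *-zeroʳ (sign (toℕ j)) (*-zeroʳ (M zero j)
      (det-zeroRow (minor M j) k λ c → Mk≈0 (punchIn j c) (Fin.punchInᵢ≢i j c)))

    σ0≢σ : ∀ r → σ zero ≢ σ (suc r)
    σ0≢σ r eq with inj eq
    ... | ()

    σ′ : Fin n → Fin n
    σ′ r = punchOut (σ0≢σ r)

    punchIn-σ′ : ∀ r → punchIn (σ zero) (σ′ r) ≡ σ (suc r)
    punchIn-σ′ r = Fin.punchIn-punchOut (σ0≢σ r)

    inj′ : Injective _≡_ _≡_ σ′
    inj′ {r} {s} eq = Fin.suc-injective (inj
      (≡.trans (≡.sym (punchIn-σ′ r)) (≡.trans (≡.cong (punchIn (σ zero)) eq) (punchIn-σ′ s))))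

    diag′ : ∀ r → minor M (σ zero) r (σ′ r) # 0#
    diag′ r = ≡.subst (λ c → M (suc r) c # 0#) (≡.sym (punchIn-σ′ r)) (diag (suc r))

    off′ : ∀ r c → c ≢ σ′ r → minor M (σ zero) r c ≈ 0# ⊎
           ∃ λ k → σ′ k ≡ c × ZeroOutside (minor M (σ zero) k) c
    off′ r c c≢ with off (suc r) (punchIn (σ zero) c)
                       (λ eq → c≢ (Fin.punchIn-injective (σ zero) _ _ (≡.trans eq (≡.sym (punchIn-σ′ r)))))
    ... | inj₁ M≈0 = inj₁ M≈0
    -- The witness cannot be row 0, because its column `σ zero` has been deleted.
    ... | inj₂ (zero  , eq , _) = contradiction (≡.sym eq) (Fin.punchInᵢ≢i (σ zero) c)
    ... | inj₂ (suc k , eq , Mk≈0) = inj₂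
      ( k
      , Fin.punchIn-injective (σ zero) _ _ (≡.trans (punchIn-σ′ k) eq)
      , λ c′ c′≢c → Mk≈0 (punchIn (σ zero) c′) (c′≢c ∘ Fin.punchIn-injective (σ zero) _ _))

-- Subsets as lists of Booleans.

toList-injective : ∀ {n} {I J : Subset n} → Vec.toList I ≡ Vec.toList J → I ≡ J
toList-injective {I = I} {J} eq =
  ≡.trans (≡.sym (Vec.cast-is-id ≡.refl I)) (Vec.toList-injective ≡.refl I J eq)

size : List Bool → ℕ
size []          = 0
size (false ∷ X) = size X
size (true  ∷ X) = suc (size X)

size-toList : ∀ {n} (I : Subset n) → size (Vec.toList I) ≡ ∣ I ∣
size-toList Vec.[]            = ≡.refl
size-toList (outside Vec.∷ I) = size-toList I
size-toList (inside  Vec.∷ I) = ≡.cong suc (size-toList I)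

size-++ : ∀ X Y → size (X ++ Y) ≡ size X ℕ.+ size Y
size-++ []          Y = ≡.refl
size-++ (false ∷ X) Y = size-++ X Y
size-++ (true  ∷ X) Y = ≡.cong suc (size-++ X Y)

-- The position of the i-th element, counting from 0 (junk beyond size X).
nth : List Bool → ℕ → ℕ
nth []          i       = 0
nth (false ∷ X) i       = suc (nth X i)
nth (true  ∷ X) zero    = 0
nth (true  ∷ X) (suc i) = suc (nth X i)

-- Contraction of functions on subsets.

module Contraction {c ℓ} (R : CommutativeRing c ℓ) where
  open CommutativeRing R hiding (zero)
  open Determinants R
  open SemiringSum semiring
  open RingProperties ring
  open SetoidReasoning setoid
  open CommutativeSemigroupProperties +-commutativeSemigroup using (interchange)

  -- contract X w y = Σ_{s ∈ X} (-1)^#{x ∈ X : x < s} w s · y (X - s)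
  contract : List Bool → (ℕ → Carrier) → (List Bool → Carrier) → Carrier
  contract []          w y = 0#
  contract (false ∷ X) w y = contract X (w ∘ suc) (y ∘ (false ∷_))
  contract (true  ∷ X) w y = w 0 * y (false ∷ X) - contract X (w ∘ suc) (y ∘ (true ∷_))

  -- The length and size conditions single out the arguments that `contract X` can pass on: lists as
  -- long as `X` with one element fewer. Later functions agree only on such lists.
  contract-cong : ∀ X {w w′ y y′} → (∀ i → w i ≈ w′ i) →
    (∀ Z → length Z ≡ length X → suc (size Z) ≡ size X → y Z ≈ y′ Z) →
    contract X w y ≈ contract X w′ y′
  contract-cong []          w≈ y≈ = refl
  contract-cong (false ∷ X) w≈ y≈ = contract-cong X (w≈ ∘ suc)
    λ Z l s → y≈ (false ∷ Z) (≡.cong suc l) s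
  contract-cong (true ∷ X)  w≈ y≈ = +-cong (*-cong (w≈ 0) (y≈ (false ∷ X) ≡.refl ≡.refl))
    (-‿cong (contract-cong X (w≈ ∘ suc) λ Z l s → y≈ (true ∷ Z) (≡.cong suc l) (≡.cong suc s)))

  contract-congʸ : ∀ X {w y y′} →
    (∀ Z → length Z ≡ length X → suc (size Z) ≡ size X → y Z ≈ y′ Z) →
    contract X w y ≈ contract X w y′
  contract-congʸ X = contract-cong X λ _ → refl

  contract-zero : ∀ X {w y} →
    (∀ Z → length Z ≡ length X → suc (size Z) ≡ size X → y Z ≈ 0#) → contract X w y ≈ 0#
  contract-zero []          y≈0 = refl
  contract-zero (false ∷ X) y≈0 = contract-zero X λ Z l s → y≈0 (false ∷ Z) (≡.cong suc l) s
  contract-zero (true ∷ X) {w} {y} y≈0 = begin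
    w 0 * y (false ∷ X) - contract X (w ∘ suc) (y ∘ (true ∷_))
      ≈⟨ +-cong (*-zeroʳ (w 0) (y≈0 (false ∷ X) ≡.refl ≡.refl))
                (-‿cong (contract-zero X λ Z l s → y≈0 (true ∷ Z) (≡.cong suc l) (≡.cong suc s))) ⟩
    0# - 0#  ≈⟨ -‿inverseʳ 0# ⟩
    0#       ∎

  contract-zeroWeight : ∀ X {w y} → (∀ i → w i ≈ 0#) → contract X w y ≈ 0#
  contract-zeroWeight []          w≈0 = refl
  contract-zeroWeight (false ∷ X) w≈0 = contract-zeroWeight X (w≈0 ∘ suc)
  contract-zeroWeight (true ∷ X) {w} {y} w≈0 = begin
    w 0 * y (false ∷ X) - contract X (w ∘ suc) (y ∘ (true ∷_))
      ≈⟨ +-cong (*-zeroˡ (y (false ∷ X)) (w≈0 0)) (-‿cong (contract-zeroWeight X (w≈0 ∘ suc))) ⟩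
    0# - 0#  ≈⟨ -‿inverseʳ 0# ⟩
    0#       ∎

  contract-+ : ∀ X w y z → contract X w (λ Z → y Z + z Z) ≈ contract X w y + contract X w z
  contract-+ []          w y z = sym (+-identityˡ 0#)
  contract-+ (false ∷ X) w y z = contract-+ X _ _ _
  contract-+ (true ∷ X)  w y z = begin
    w 0 * (y (false ∷ X) + z (false ∷ X)) - contract X _ (λ Z → y (true ∷ Z) + z (true ∷ Z))
      ≈⟨ +-cong (distribˡ _ _ _) (trans (-‿cong (contract-+ X _ _ _)) (sym (-‿+-comm _ _))) ⟩
    (w 0 * y (false ∷ X) + w 0 * z (false ∷ X)) + (- contract X _ (y ∘ (true ∷_)) - contract X _ (z ∘ (true ∷_)))
      ≈⟨ interchange _ _ _ _ ⟩
    contract (true ∷ X) w y + contract (true ∷ X) w z ∎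

  contract-* : ∀ X w y x → contract X w (λ Z → y Z * x) ≈ contract X w y * x
  contract-* []          w y x = sym (zeroˡ x)
  contract-* (false ∷ X) w y x = contract-* X _ _ x
  contract-* (true ∷ X)  w y x = begin
    w 0 * (y (false ∷ X) * x) - contract X _ (λ Z → y (true ∷ Z) * x)
      ≈⟨ +-cong (sym (*-assoc _ _ _)) (-‿cong (contract-* X _ _ x)) ⟩
    w 0 * y (false ∷ X) * x - contract X _ (y ∘ (true ∷_)) * x
      ≈⟨ [y-z]x≈yx-zx _ _ _ ⟨
    contract (true ∷ X) w y * x ∎

  contract-sum : ∀ {n} X w (y : Fin n → List Bool → Carrier) →
    contract X w (λ Z → sum λ j → y j Z) ≈ sum λ j → contract X w (y j)
  contract-sum {zero}  X w y = contract-zero X λ _ _ _ → refl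
  contract-sum {suc n} X w y = trans (contract-+ X w (y zero) (λ Z → sum λ j → y (suc j) Z))
    (+-congˡ (contract-sum X w (y ∘ suc)))

  -- The deleted element lies in `X` or in `Z`; in the second case all of `X` lies below it, which
  -- gives the sign.
  contract-++ : ∀ X Z w y → contract (X ++ Z) w y ≈
    contract X w (λ X′ → y (X′ ++ Z)) +
    sign (size X) * contract Z (w ∘ (length X ℕ.+_)) (λ Z′ → y (X ++ Z′))
  contract-++ []          Z w y = sym (trans (+-identityˡ _) (*-identityˡ _))
  contract-++ (false ∷ X) Z w y = contract-++ X Z (w ∘ suc) (y ∘ (false ∷_))
  contract-++ (true ∷ X)  Z w y = begin
    p - contract (X ++ Z) (w ∘ suc) (y ∘ (true ∷_))
      ≈⟨ +-congˡ (-‿cong (contract-++ X Z (w ∘ suc) (y ∘ (true ∷_)))) ⟩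
    p - (q + sign (size X) * r)
      ≈⟨ +-congˡ (-‿+-comm _ _) ⟨
    p + (- q - sign (size X) * r)
      ≈⟨ +-assoc _ _ _ ⟨
    (p - q) - sign (size X) * r
      ≈⟨ +-congˡ (sign-suc (size X) r) ⟨
    (p - q) + sign (suc (size X)) * r ∎
    where
    p = w 0 * y (false ∷ X ++ Z)
    q = contract X (w ∘ suc) (λ X′ → y (true ∷ X′ ++ Z))
    r = contract Z (λ i → w (suc (length X ℕ.+ i))) (λ Z′ → y (true ∷ X ++ Z′))

  -- Exactly `j` elements of `X` lie below its `j`-th one, and deleting that one turns `nth X` into
  -- `nth X` after `punchIn j`. So first-row expansion over the columns in `X` is a contraction.
  laplace-columns : ∀ X {m} → size X ≡ suc m → ∀ (w : ℕ → Carrier)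
    (Φ : (Fin m → ℕ) → Carrier) → (∀ {f g} → f ≗ g → Φ f ≈ Φ g) →
    (Ψ : List Bool → Carrier) →
    (∀ Z → length Z ≡ length X → size Z ≡ m → Ψ Z ≈ Φ (nth Z ∘ toℕ)) →
    sum (λ (j : Fin (suc m)) → sign (toℕ j) * (w (nth X (toℕ j)) * Φ (λ c → nth X (toℕ (punchIn j c)))))
      ≈ contract X w Ψ
  laplace-columns (false ∷ X) eq w Φ ext Ψ Ψ≈Φ = laplace-columns X eq (w ∘ suc) (λ f → Φ (suc ∘ f))
    (λ f≗g → ext (≡.cong suc ∘ f≗g)) (Ψ ∘ (false ∷_)) λ Z l s → Ψ≈Φ (false ∷ Z) (≡.cong suc l) s
  laplace-columns (true ∷ X) {zero} eq w Φ ext Ψ Ψ≈Φ = +-cong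
    (trans (*-identityˡ _) (*-congˡ (trans (ext λ ()) (sym (Ψ≈Φ (false ∷ X) ≡.refl (ℕ.suc-injective eq))))))
    -- Here the leading element was the only one, so the tail has none to delete.
    (sym (trans (-‿cong (contract-zero X λ Z _ s → contradiction (≡.trans s (ℕ.suc-injective eq)) ℕ.1+n≢0)) -0#≈0#))
  laplace-columns (true ∷ X) {suc m} eq w Φ ext Ψ Ψ≈Φ = +-cong
    (trans (*-identityˡ _) (*-congˡ (sym (Ψ≈Φ (false ∷ X) ≡.refl (ℕ.suc-injective eq)))))
    (begin
      sum (λ j → sign (suc (toℕ j)) * term j)
        ≈⟨ sum-cong {suc m} (λ j → sign-suc (toℕ j) (term j)) ⟩
      sum (λ j → - (sign (toℕ j) * term j))
        ≈⟨ sum-neg {suc m} (λ j → sign (toℕ j) * term j) ⟩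
      - sum (λ j → sign (toℕ j) * term j)
        ≈⟨ -‿cong (sum-cong {suc m} λ j → *-congˡ {sign (toℕ j)} (*-congˡ {w (suc (nth X (toℕ j)))} (ext (punchIn-cons j)))) ⟩
      - sum (λ j → sign (toℕ j) * (w (suc (nth X (toℕ j))) * Φ (cons (λ c → nth X (toℕ (punchIn j c))))))
        ≈⟨ -‿cong (laplace-columns X (ℕ.suc-injective eq) (w ∘ suc) (Φ ∘ cons) (ext ∘ cons-cong)
             (Ψ ∘ (true ∷_)) (λ Z l s → trans (Ψ≈Φ (true ∷ Z) (≡.cong suc l) (≡.cong suc s)) (ext (nth-cons Z)))) ⟩
      - contract X (w ∘ suc) (Ψ ∘ (true ∷_)) ∎)
    where
    cons : ∀ {k} → (Fin k → ℕ) → Fin (suc k) → ℕ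
    cons f zero    = 0
    cons f (suc c) = suc (f c)

    cons-cong : ∀ {k} {f g : Fin k → ℕ} → f ≗ g → cons f ≗ cons g
    cons-cong f≗g zero    = ≡.refl
    cons-cong f≗g (suc c) = ≡.cong suc (f≗g c)

    term : Fin (suc m) → Carrier
    term j = w (suc (nth X (toℕ j))) * Φ (λ c → nth (true ∷ X) (toℕ (punchIn (suc j) c)))

    punchIn-cons : ∀ j → (λ c → nth (true ∷ X) (toℕ (punchIn (suc j) c))) ≗ cons (λ c → nth X (toℕ (punchIn j c)))
    punchIn-cons j zero    = ≡.refl
    punchIn-cons j (suc c) = ≡.refl

    nth-cons : ∀ Z → nth (true ∷ Z) ∘ toℕ ≗ cons (nth Z ∘ toℕ {m})
    nth-cons Z zero    = ≡.refl
    nth-cons Z (suc c) = ≡.refl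

  -- Recursion instead of an equality test lets a contracted indicator compute one position at a
  -- time.
  indicator : List Bool → List Bool → Carrier
  indicator []          []          = 1#
  indicator (false ∷ X) (false ∷ Y) = indicator X Y
  indicator (true  ∷ X) (true  ∷ Y) = indicator X Y
  indicator _           _           = 0#

  indicator-refl : ∀ X → indicator X X ≈ 1#
  indicator-refl []          = refl
  indicator-refl (false ∷ X) = indicator-refl X
  indicator-refl (true  ∷ X) = indicator-refl X

  indicator-≢ : ∀ {X Y} → X ≢ Y → indicator X Y ≈ 0#
  indicator-≢ {[]}        {[]}        X≢Y = contradiction ≡.refl X≢Y
  indicator-≢ {[]}        {_ ∷ _}     X≢Y = refl
  indicator-≢ {false ∷ X} {[]}        X≢Y = refl
  indicator-≢ {false ∷ X} {false ∷ Y} X≢Y = indicator-≢ (X≢Y ∘ ≡.cong (false ∷_))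
  indicator-≢ {false ∷ X} {true ∷ Y}  X≢Y = refl
  indicator-≢ {true ∷ X}  {[]}        X≢Y = refl
  indicator-≢ {true ∷ X}  {false ∷ Y} X≢Y = refl
  indicator-≢ {true ∷ X}  {true ∷ Y}  X≢Y = indicator-≢ (X≢Y ∘ ≡.cong (true ∷_))

  position-sign : ∀ {n} → Fin n → Subset n → Carrier
  position-sign zero    X                 = 1#
  position-sign (suc s) (outside Vec.∷ X) = position-sign s X
  position-sign (suc s) (inside  Vec.∷ X) = - position-sign s X

  -- The cardinality condition says that `s` is not in `Z`, so deleting `s` is the only way to reach
  -- `Z`.
  contract-indicator-∪ : ∀ {n} w (Z : Subset n) s → ∣ Z ∪ ⁅ s ⁆ ∣ ≡ suc ∣ Z ∣ →
    contract (Vec.toList (Z ∪ ⁅ s ⁆)) w (indicator (Vec.toList Z)) ≈ position-sign s (Z ∪ ⁅ s ⁆) * w (toℕ s)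
  contract-indicator-∪ w (outside Vec.∷ Z) zero eq rewrite Subset.∪-identityʳ Z = begin
    w 0 * indicator (Vec.toList Z) (Vec.toList Z) - contract (Vec.toList Z) (w ∘ suc) (λ _ → 0#)
      ≈⟨ +-cong (*-congˡ (indicator-refl (Vec.toList Z))) (-‿cong (contract-zero (Vec.toList Z) λ _ _ _ → refl)) ⟩
    w 0 * 1# - 0#   ≈⟨ +-cong (*-comm _ _) -0#≈0# ⟩
    1# * w 0 + 0#   ≈⟨ +-identityʳ _ ⟩
    1# * w 0        ∎
  contract-indicator-∪ w (inside Vec.∷ Z) zero eq rewrite Subset.∪-identityʳ Z =
    contradiction (≡.sym (ℕ.suc-injective eq)) ℕ.1+n≢n
  contract-indicator-∪ w (outside Vec.∷ Z) (suc s) eq = contract-indicator-∪ (w ∘ suc) Z s eq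
  contract-indicator-∪ w (inside Vec.∷ Z) (suc s) eq = begin
    w 0 * 0# - contract (Vec.toList (Z ∪ ⁅ s ⁆)) (w ∘ suc) (indicator (Vec.toList Z))
      ≈⟨ +-cong (zeroʳ _) (-‿cong (contract-indicator-∪ (w ∘ suc) Z s (ℕ.suc-injective eq))) ⟩
    0# - position-sign s (Z ∪ ⁅ s ⁆) * w (suc (toℕ s))   ≈⟨ +-identityˡ _ ⟩
    - (position-sign s (Z ∪ ⁅ s ⁆) * w (suc (toℕ s)))    ≈⟨ -‿distribˡ-* _ _ ⟩
    - position-sign s (Z ∪ ⁅ s ⁆) * w (suc (toℕ s))      ∎

  contract-indicator-∌ : ∀ {n} w (X Z : Subset n) → (∀ s → X ≢ Z ∪ ⁅ s ⁆) →
    contract (Vec.toList X) w (indicator (Vec.toList Z)) ≈ 0#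
  contract-indicator-∌ w Vec.[] Vec.[] X≢ = refl
  contract-indicator-∌ w (outside Vec.∷ X) (outside Vec.∷ Z) X≢ =
    contract-indicator-∌ (w ∘ suc) X Z λ s → X≢ (suc s) ∘ ≡.cong (outside Vec.∷_)
  contract-indicator-∌ w (outside Vec.∷ X) (inside Vec.∷ Z) X≢ = contract-zero (Vec.toList X) λ _ _ _ → refl
  contract-indicator-∌ w (inside Vec.∷ X) (inside Vec.∷ Z) X≢ = begin
    w 0 * 0# - contract (Vec.toList X) (w ∘ suc) (indicator (Vec.toList Z))
      ≈⟨ +-cong (zeroʳ _) (-‿cong (contract-indicator-∌ (w ∘ suc) X Z λ s → X≢ (suc s) ∘ ≡.cong (inside Vec.∷_))) ⟩
    0# - 0#  ≈⟨ -‿inverseʳ 0# ⟩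
    0#       ∎
  contract-indicator-∌ w (inside Vec.∷ X) (outside Vec.∷ Z) X≢ = begin
    w 0 * indicator (Vec.toList Z) (Vec.toList X) - contract (Vec.toList X) (w ∘ suc) (λ _ → 0#)
      ≈⟨ +-cong (*-zeroʳ (w 0) (indicator-≢ Z≢X)) (-‿cong (contract-zero (Vec.toList X) λ _ _ _ → refl)) ⟩
    0# - 0#  ≈⟨ -‿inverseʳ 0# ⟩
    0#       ∎
    where
    Z≢X : Vec.toList Z ≢ Vec.toList X
    Z≢X eq = X≢ zero (≡.cong (inside Vec.∷_) (≡.trans (≡.sym (toList-injective eq)) (≡.sym (Subset.∪-identityʳ Z))))

  -- y on subsets of [-b, a-1], read on the subsets J + 1 of [-b, a].
  shift : (List Bool → Carrier) → List Bool → Carrier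
  shift y (false ∷ J) = y J
  shift y _           = 0#

  -- No set `J + 1` contains `-b`, so a row whose subset contains `-b` must delete it: such a row of
  -- `T` has a single entry.
  contract-inside : ∀ L w y → contract (true ∷ L ++ true ∷ []) w (shift y) ≈ w 0 * y (L ++ true ∷ [])
  contract-inside L w y = begin
    w 0 * y (L ++ true ∷ []) - contract (L ++ true ∷ []) (w ∘ suc) (λ _ → 0#)
      ≈⟨ +-congˡ (-‿cong (contract-zero (L ++ true ∷ []) λ _ _ _ → refl)) ⟩
    w 0 * y (L ++ true ∷ []) - 0#   ≈⟨ +-congˡ -0#≈0# ⟩
    w 0 * y (L ++ true ∷ []) + 0#   ≈⟨ +-identityʳ _ ⟩
    w 0 * y (L ++ true ∷ [])        ∎

  -- Either an element other than `a` is deleted, and the new set ends with `a - 1`, or `a` itself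
  -- is deleted and the set is merely lowered by 1.
  contract-outside : ∀ L w y → contract (false ∷ L ++ true ∷ []) w (shift y) ≈
    contract L (w ∘ suc) (λ Z → y (Z ++ true ∷ [])) +
    sign (size L) * (w (suc (length L)) * y (L ++ false ∷ []))
  contract-outside L w y = trans (contract-++ L (true ∷ []) (w ∘ suc) y)
    (+-congˡ (*-congˡ (begin
      w (suc (length L ℕ.+ 0)) * y (L ++ false ∷ []) - 0#  ≈⟨ +-cong (*-congʳ (reflexive (≡.cong (w ∘ suc) (ℕ.+-identityʳ (length L))))) -0#≈0# ⟩
      w (suc (length L)) * y (L ++ false ∷ []) + 0#        ≈⟨ +-identityʳ _ ⟩
      w (suc (length L)) * y (L ++ false ∷ [])             ∎)))

  indicator-shift : ∀ X Z → indicator (false ∷ X) Z ≈ shift (indicator X) Z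
  indicator-shift X []          = refl
  indicator-shift X (false ∷ Z) = refl
  indicator-shift X (true ∷ Z)  = refl

-- Enumeration of the subsets of a given size.

filter-map : ∀ {a b p} {A : Set a} {B : Set b} {P : Pred B p} (P? : Decidable P) (f : A → B) xs →
  filter P? (map f xs) ≡ map f (filter (P? ∘ f) xs)
filter-map P? f []       = ≡.refl
filter-map P? f (x ∷ xs) with does (P? (f x))
... | false = filter-map P? f xs
... | true  = ≡.cong (f x ∷_) (filter-map P? f xs)

subsetsOfSize-suc : ∀ n k → subsetsOfSize (suc n) (suc k) ≡
  map (outside Vec.∷_) (subsetsOfSize n (suc k)) ++ map (inside Vec.∷_) (subsetsOfSize n k)
subsetsOfSize-suc n k = begin
  filter P? (map (outside Vec.∷_) (allSubsets n) ++ map (inside Vec.∷_) (allSubsets n))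
    ≡⟨ List.filter-++ P? (map (outside Vec.∷_) (allSubsets n)) _ ⟩
  filter P? (map (outside Vec.∷_) (allSubsets n)) ++ filter P? (map (inside Vec.∷_) (allSubsets n))
    ≡⟨ ≡.cong₂ _++_ (filter-map P? (outside Vec.∷_) (allSubsets n)) (filter-map P? (inside Vec.∷_) (allSubsets n)) ⟩
  map (outside Vec.∷_) (subsetsOfSize n (suc k)) ++ map (inside Vec.∷_) (filter (λ I → suc ∣ I ∣ ℕ.≟ suc k) (allSubsets n))
    ≡⟨ ≡.cong (λ xs → map (outside Vec.∷_) (subsetsOfSize n (suc k)) ++ map (inside Vec.∷_) xs)
         (List.filter-≐ _ (λ I → ∣ I ∣ ℕ.≟ k) (ℕ.suc-injective , ≡.cong suc) (allSubsets n)) ⟩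
  map (outside Vec.∷_) (subsetsOfSize n (suc k)) ++ map (inside Vec.∷_) (subsetsOfSize n k) ∎
  where
  open ≡-Reasoning
  P? : Decidable (λ (I : Subset (suc n)) → ∣ I ∣ ≡ suc k)
  P? I = ∣ I ∣ ℕ.≟ suc k

subsetsOfSize-zero : ∀ n → subsetsOfSize (suc n) 0 ≡ map (outside Vec.∷_) (subsetsOfSize n 0)
subsetsOfSize-zero n = begin
  filter P? (map (outside Vec.∷_) (allSubsets n) ++ map (inside Vec.∷_) (allSubsets n))
    ≡⟨ List.filter-++ P? (map (outside Vec.∷_) (allSubsets n)) _ ⟩
  filter P? (map (outside Vec.∷_) (allSubsets n)) ++ filter P? (map (inside Vec.∷_) (allSubsets n))
    ≡⟨ ≡.cong₂ _++_ (filter-map P? (outside Vec.∷_) (allSubsets n)) (filter-map P? (inside Vec.∷_) (allSubsets n)) ⟩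
  map (outside Vec.∷_) (subsetsOfSize n 0) ++ map (inside Vec.∷_) (filter (λ I → suc ∣ I ∣ ℕ.≟ 0) (allSubsets n))
    ≡⟨ ≡.cong (λ xs → map (outside Vec.∷_) (subsetsOfSize n 0) ++ map (inside Vec.∷_) xs)
         (List.filter-none (λ I → suc ∣ I ∣ ℕ.≟ 0) (All.universal (λ _ ()) (allSubsets n))) ⟩
  map (outside Vec.∷_) (subsetsOfSize n 0) ++ []
    ≡⟨ List.++-identityʳ _ ⟩
  map (outside Vec.∷_) (subsetsOfSize n 0) ∎
  where
  open ≡-Reasoning
  P? : Decidable (λ (I : Subset (suc n)) → ∣ I ∣ ≡ 0)
  P? I = ∣ I ∣ ℕ.≟ 0

length-subsetsOfSize : ∀ n k → length (subsetsOfSize n k) ≡ n C k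
length-subsetsOfSize zero    zero    = ≡.refl
length-subsetsOfSize zero    (suc k) = ≡.refl
length-subsetsOfSize (suc n) zero    = ≡.trans (≡.cong length (subsetsOfSize-zero n))
  (≡.trans (List.length-map _ (subsetsOfSize n 0)) (length-subsetsOfSize n 0))
length-subsetsOfSize (suc n) (suc k) = begin
  length (subsetsOfSize (suc n) (suc k))
    ≡⟨ ≡.cong length (subsetsOfSize-suc n k) ⟩
  length (map (outside Vec.∷_) (subsetsOfSize n (suc k)) ++ map (inside Vec.∷_) (subsetsOfSize n k))
    ≡⟨ List.length-++ (map (outside Vec.∷_) (subsetsOfSize n (suc k))) ⟩
  length (map (outside Vec.∷_) (subsetsOfSize n (suc k))) ℕ.+ length (map (inside Vec.∷_) (subsetsOfSize n k))
    ≡⟨ ≡.cong₂ ℕ._+_ (List.length-map _ (subsetsOfSize n (suc k))) (List.length-map _ (subsetsOfSize n k)) ⟩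
  length (subsetsOfSize n (suc k)) ℕ.+ length (subsetsOfSize n k)
    ≡⟨ ≡.cong₂ ℕ._+_ (length-subsetsOfSize n (suc k)) (length-subsetsOfSize n k) ⟩
  n C suc k ℕ.+ n C k
    ≡⟨ ℕ.+-comm (n C suc k) (n C k) ⟩
  n C k ℕ.+ n C suc k
    ≡⟨ nCk+nC[k+1]≡[n+1]C[k+1] n k ⟩
  suc n C suc k ∎
  where open ≡-Reasoning

∈-allSubsets : ∀ {n} (I : Subset n) → I ∈ allSubsets n
∈-allSubsets Vec.[]            = here ≡.refl
∈-allSubsets (outside Vec.∷ I) = ∈.∈-++⁺ˡ (∈.∈-map⁺ (outside Vec.∷_) (∈-allSubsets I))
∈-allSubsets (inside  Vec.∷ I) =
  ∈.∈-++⁺ʳ (map (outside Vec.∷_) (allSubsets _)) (∈.∈-map⁺ (inside Vec.∷_) (∈-allSubsets I))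

allSubsets-unique : ∀ n → Unique (allSubsets n)
allSubsets-unique zero    = [] ∷ []
allSubsets-unique (suc n) = Unique.++⁺
  (Unique.map⁺ Vec.∷-injectiveʳ (allSubsets-unique n))
  (Unique.map⁺ Vec.∷-injectiveʳ (allSubsets-unique n))
  λ (∈outs , ∈ins) → outs≢ins (∈.∈-map⁻ _ ∈outs) (∈.∈-map⁻ _ ∈ins)
  where
  outs≢ins : ∀ {I : Subset (suc n)} {xs ys : List (Subset n)} →
    (∃ λ J → J ∈ xs × I ≡ outside Vec.∷ J) → (∃ λ J → J ∈ ys × I ≡ inside Vec.∷ J) → _
  outs≢ins (_ , _ , ≡.refl) (_ , _ , ())

lookup-injective : ∀ {a} {A : Set a} {xs : List A} → Unique xs → Injective _≡_ _≡_ (lookup xs)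
lookup-injective (_ ∷ _)     {zero}  {zero}  eq = ≡.refl
lookup-injective (x∉ ∷ _)    {zero}  {suc j} eq = contradiction eq (All.lookup x∉ (∈.∈-lookup j))
lookup-injective (x∉ ∷ _)    {suc i} {zero}  eq = contradiction (≡.sym eq) (All.lookup x∉ (∈.∈-lookup i))
lookup-injective (_ ∷ uniq)  {suc i} {suc j} eq = ≡.cong suc (lookup-injective uniq eq)

-- Position i stands for i - b, so this is [0, a-1].
interval : ∀ b a → Subset (b ℕ.+ a)
interval b a = ⊥ {b} Vec.++ ⊤ {a}

subsetsOfSize-full : ∀ a → subsetsOfSize a a ≡ ⊤ ∷ []
subsetsOfSize-full zero    = ≡.refl
subsetsOfSize-full (suc a) = ≡.trans (subsetsOfSize-suc a a) (≡.cong₂ _++_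
  (≡.cong (map (outside Vec.∷_)) (List.filter-none (λ I → ∣ I ∣ ℕ.≟ suc a)
    (All.universal (λ I eq → ℕ.1+n≰n (≡.subst (Data.Nat.Base._≤ a) eq (Subset.∣p∣≤n I))) (allSubsets a))))
  (≡.cong (map (inside Vec.∷_)) (subsetsOfSize-full a)))

-- The enumeration is lexicographic with `outside` first, so `[0, a-1]` comes first. This puts `I₀`
-- at index zero, and its cofactors are those of the first row, which `det` expands along.
subsetsOfSize-head : ∀ b a → ∃ λ rest → subsetsOfSize (b ℕ.+ a) a ≡ interval b a ∷ rest
subsetsOfSize-head zero    a    = [] , subsetsOfSize-full a
subsetsOfSize-head (suc b) zero with rest , eq ← subsetsOfSize-head b zero =
  map (outside Vec.∷_) rest , ≡.trans (subsetsOfSize-zero (b ℕ.+ 0)) (≡.cong (map (outside Vec.∷_)) eq)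
subsetsOfSize-head (suc b) (suc a) with rest , eq ← subsetsOfSize-head b (suc a) =
  _ , ≡.trans (subsetsOfSize-suc (b ℕ.+ suc a) a)
        (≡.cong (λ xs → map (outside Vec.∷_) xs ++ map (inside Vec.∷_) (subsetsOfSize (b ℕ.+ suc a) a)) eq)

subsetsOfSize-unique : ∀ n k → Unique (subsetsOfSize n k)
subsetsOfSize-unique n k = Unique.filter⁺ (λ I → ∣ I ∣ ℕ.≟ k) (allSubsets-unique n)

filter-≢-head : ∀ {n} {I : Subset n} {rest} → Unique (I ∷ rest) →
  filter (λ J → ¬? (J ≟ˢ I)) (I ∷ rest) ≡ rest
filter-≢-head {I = I} {rest} (I∉ ∷ _) = ≡.trans
  (List.filter-reject (λ J → ¬? (J ≟ˢ I)) λ I≢I → I≢I ≡.refl)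
  (List.filter-all (λ J → ¬? (J ≟ˢ I)) (All.map (λ I≢J → I≢J ∘ ≡.sym) I∉))

size≤length : ∀ X → size X ℕ.≤ length X
size≤length []          = ℕ.z≤n
size≤length (false ∷ X) = ℕ.m≤n⇒m≤1+n (size≤length X)
size≤length (true ∷ X)  = ℕ.s≤s (size≤length X)

size-trues : ∀ n → size (replicate n true) ≡ n
size-trues zero    = ≡.refl
size-trues (suc n) = ≡.cong suc (size-trues n)

size-falses : ∀ n → size (replicate n false) ≡ 0
size-falses zero    = ≡.refl
size-falses (suc n) = size-falses n

size≡0⇒falses : ∀ X → size X ≡ 0 → X ≡ replicate (length X) false
size≡0⇒falses []          eq = ≡.refl
size≡0⇒falses (false ∷ X) eq = ≡.cong (false ∷_) (size≡0⇒falses X eq)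

nth-interval : ∀ b n i → i ℕ.< n → nth (replicate b false ++ replicate n true) i ≡ b ℕ.+ i
nth-interval (suc b) n       i       i<n         = ≡.cong suc (nth-interval b n i i<n)
nth-interval zero    (suc n) zero    i<n         = ≡.refl
nth-interval zero    (suc n) (suc i) (ℕ.s≤s i<n) = ≡.cong suc (nth-interval zero n i i<n)

++-injectiveʳ : ∀ {A : Set} (X X′ : List A) {Z Z′} → length X ≡ length X′ → X ++ Z ≡ X′ ++ Z′ → Z ≡ Z′
++-injectiveʳ []      []       l eq = eq
++-injectiveʳ (_ ∷ X) (_ ∷ X′) l eq = ++-injectiveʳ X X′ (ℕ.suc-injective l) (List.∷-injectiveʳ eq)

toList-surjective : ∀ {n} (L : List Bool) → length L ≡ n → ∃ λ (I : Subset n) → Vec.toList I ≡ L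
toList-surjective L ≡.refl = Vec.fromList L , Vec.toList∘fromList L

toList-interval : ∀ b a → Vec.toList (interval b a) ≡ replicate b false ++ replicate a true
toList-interval b a = ≡.trans (Vec.toList-++ (⊥ {b}) (⊤ {a}))
  (≡.cong₂ _++_ (Vec.toList-replicate b false) (Vec.toList-replicate a true))

-- The transfer matrix as a step of the expansion of `F`.

module Transfer {c ℓ₁ ℓ₂} (K : HeytingField c ℓ₁ ℓ₂)
                (ω : ℤ → HeytingField.Carrier K) (a b : ℕ) where
  open Weighted K ω a b
  open FieldDeterminants K
  open CommutativeRing commRing hiding (zero)
  open Determinants commRing
  open Contraction commRing
  open Matrices rawRing
  open RingProperties ring
  open SemiringSum semiring
  open SetoidReasoning setoid

  weight : ℕ → Carrier
  weight i = β (i ⊖ b)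

  I₀-list : List Bool
  I₀-list = replicate b false ++ replicate a true

  shift-cong : ∀ {y y′} Z → (∀ J → Z ≡ false ∷ J → y J ≈ y′ J) → shift y Z ≈ shift y′ Z
  shift-cong []          y≈ = refl
  shift-cong (false ∷ J) y≈ = y≈ J ≡.refl
  shift-cong (true ∷ J)  y≈ = refl

  -- The appended position is the last one and never lies below `s`, so adjoining `a` leaves the
  -- sign unchanged.
  ε≈position-sign : ∀ {n} (s : Fin (suc n)) (I : Subset n) x →
    sign ∣ I ∩ Vec.tabulate (λ i → does (toℕ i ℕ.<? toℕ s)) ∣ ≈ position-sign s (I Vec.∷ʳ x)
  ε≈position-sign zero    I x = reflexive (≡.cong sign (nothing-before I))
    where
    nothing-before : ∀ {n} (I : Subset n) → ∣ I ∩ Vec.tabulate (λ i → does (toℕ i ℕ.<? 0)) ∣ ≡ 0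
    nothing-before Vec.[]            = ≡.refl
    nothing-before (outside Vec.∷ I) = nothing-before I
    nothing-before (inside  Vec.∷ I) = nothing-before I
  ε≈position-sign (suc s) (outside Vec.∷ I) x = ε≈position-sign s I x
  ε≈position-sign (suc s) (inside  Vec.∷ I) x = trans (-1*x≈-x _) (-‿cong (ε≈position-sign s I x))

  ∣∷ʳ∣ : ∀ {n} (I : Subset n) x → ∣ I Vec.∷ʳ x ∣ ≡ ∣ x Vec.∷ I ∣
  ∣∷ʳ∣ Vec.[]            x       = ≡.refl
  ∣∷ʳ∣ (outside Vec.∷ I) outside = ∣∷ʳ∣ I outside
  ∣∷ʳ∣ (outside Vec.∷ I) inside  = ∣∷ʳ∣ I inside
  ∣∷ʳ∣ (inside Vec.∷ I)  outside = ≡.cong suc (∣∷ʳ∣ I outside)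
  ∣∷ʳ∣ (inside Vec.∷ I)  inside  = ≡.cong suc (∣∷ʳ∣ I inside)

  -- Equal cardinalities force any `s` found by the search to lie outside `J + 1`; if none is found,
  -- no deletion from `I ∪ {a}` leaves `J + 1`.
  T≈contract : ∀ I J → ∣ I ∣ ≡ ∣ J ∣ →
    T I J ≈ contract (Vec.toList I ++ true ∷ []) weight (indicator (false ∷ Vec.toList J))
  T≈contract I J ∣I∣≡∣J∣ rewrite ≡.sym (Vec.toList-∷ʳ true I)
    with Fin.any? (λ s → I∪⟨a⟩ I ≟ˢ ((J +1) ∪ ⁅ s ⁆))
  ... | yes (s , eq) = begin
    ε s I * β (value s)
      ≈⟨ *-congʳ (ε≈position-sign s I inside) ⟩
    position-sign s (I Vec.∷ʳ inside) * weight (toℕ s)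
      ≈⟨ reflexive (≡.cong (λ X → position-sign s X * weight (toℕ s)) eq) ⟩
    position-sign s ((J +1) ∪ ⁅ s ⁆) * weight (toℕ s)
      ≈⟨ contract-indicator-∪ weight (J +1) s
           (≡.trans (≡.cong ∣_∣ (≡.sym eq)) (≡.trans (∣∷ʳ∣ I inside) (≡.cong suc ∣I∣≡∣J∣))) ⟨
    contract (Vec.toList ((J +1) ∪ ⁅ s ⁆)) weight (indicator (Vec.toList (J +1)))
      ≈⟨ reflexive (≡.cong (λ X → contract (Vec.toList X) weight (indicator (Vec.toList (J +1)))) eq) ⟨
    contract (Vec.toList (I Vec.∷ʳ inside)) weight (indicator (Vec.toList (J +1))) ∎
  ... | no ∄s = sym (contract-indicator-∌ weight (I Vec.∷ʳ inside) (J +1) λ s eq → ∄s (s , eq))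

  Admissible : List Bool → Set
  Admissible L = length L ≡ b ℕ.+ a × size L ≡ a

  module Enumerated {m} (J : Fin (suc m) → Index) (J-injective : Injective _≡_ _≡_ J)
    (∣J∣ : ∀ j → ∣ J j ∣ ≡ a) (J-surjective : ∀ I → ∣ I ∣ ≡ a → ∃ λ j → J j ≡ I) where

    list : Fin (suc m) → List Bool
    list j = Vec.toList (J j)

    list-admissible : ∀ j → Admissible (list j)
    list-admissible j = Vec.length-toList (J j) , ≡.trans (size-toList (J j)) (∣J∣ j)

    list-surjective : ∀ L → Admissible L → ∃ λ j → list j ≡ L
    list-surjective L (len , sz) with toList-surjective L len
    ... | I , ≡.refl with J-surjective I (≡.trans (≡.sym (size-toList I)) sz)
    ... | j , eq = j , ≡.cong Vec.toList eq

    -- Extension by zero off the enumerated subsets, so that a vector can be contracted.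
    onLists : (Fin (suc m) → Carrier) → List Bool → Carrier
    onLists v L = sum λ j → indicator (list j) L * v j

    onLists-list : ∀ v i → onLists v (list i) ≈ v i
    onLists-list v i = begin
      onLists v (list i)
        ≈⟨ sum-single (λ j → indicator (list j) (list i) * v j) i
             (λ j j≢i → *-zeroˡ (v j) (indicator-≢ (j≢i ∘ J-injective ∘ toList-injective))) ⟩
      indicator (list i) (list i) * v i  ≈⟨ *-congʳ (indicator-refl (list i)) ⟩
      1# * v i                           ≈⟨ *-identityˡ _ ⟩
      v i                                ∎

    onLists-restrict : ∀ y L → Admissible L → onLists (y ∘ list) L ≈ y L
    onLists-restrict y L adm with list-surjective L adm
    ... | i , ≡.refl = onLists-list (y ∘ list) i

    T-action : ∀ i v → sum (λ j → T (J i) (J j) * v j) ≈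
      contract (list i ++ true ∷ []) weight (shift (onLists v))
    T-action i v = begin
      sum (λ j → T (J i) (J j) * v j)
        ≈⟨ sum-cong (λ j → *-congʳ {v j} (T≈contract (J i) (J j) (≡.trans (∣J∣ i) (≡.sym (∣J∣ j))))) ⟩
      sum (λ j → contract X weight (indicator (false ∷ list j)) * v j)
        ≈⟨ sum-cong (λ j → contract-* X weight (indicator (false ∷ list j)) (v j)) ⟨
      sum (λ j → contract X weight (λ Z → indicator (false ∷ list j) Z * v j))
        ≈⟨ contract-sum X weight (λ j Z → indicator (false ∷ list j) Z * v j) ⟨
      contract X weight (λ Z → sum λ j → indicator (false ∷ list j) Z * v j)
        ≈⟨ contract-congʸ X (λ Z _ _ → shifted Z) ⟩
      contract X weight (shift (onLists v)) ∎
      where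
      X = list i ++ true ∷ []
      shifted : ∀ Z → sum (λ j → indicator (false ∷ list j) Z * v j) ≈ shift (onLists v) Z
      shifted []          = sum-zero λ j → zeroˡ (v j)
      shifted (true ∷ Z)  = sum-zero λ j → zeroˡ (v j)
      shifted (false ∷ Z) = refl

    private
      size-snoc : ∀ i → size (list i ++ true ∷ []) ≡ suc a
      size-snoc i = ≡.trans (size-++ (list i) (true ∷ []))
        (≡.trans (ℕ.+-comm _ 1) (≡.cong suc (proj₂ (list-admissible i))))

      length-snoc : ∀ i → length (list i ++ true ∷ []) ≡ suc (b ℕ.+ a)
      length-snoc i = ≡.trans (List.length-++ (list i))
        (≡.trans (ℕ.+-comm _ 1) (≡.cong suc (proj₁ (list-admissible i))))

    -- Here `y` need not vanish off the admissible lists, but deleting one of the `a + 1` elements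
    -- and shifting reads it only at admissible ones.
    T-action-restrict : ∀ i y → sum (λ j → T (J i) (J j) * y (list j)) ≈
      contract (list i ++ true ∷ []) weight (shift y)
    T-action-restrict i y = trans (T-action i (y ∘ list)) (contract-congʸ (list i ++ true ∷ [])
      λ Z len sz → shift-cong Z λ where
        L ≡.refl → onLists-restrict y L
          ( ℕ.suc-injective (≡.trans len (length-snoc i))
          , ℕ.suc-injective (≡.trans sz (size-snoc i))))

  -- n rows of the determinant F are still to be expanded, and X is the set of columns
  -- left in [-b, n+a-1]; columns from n on are padding, which must never be chosen.
  remaining : ℕ → List Bool → Carrier
  remaining zero    X = indicator I₀-list X
  remaining (suc n) X = contract X weight (shift (remaining n))

  module Banded (β-high : ∀ i → β ((suc (b ℕ.+ a) ℕ.+ i) ⊖ b) ≈ 0#)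
                (β-low : ∀ r → β (0 ⊖ suc (r ℕ.+ b)) ≈ 0#) where

    state : ℕ → List Bool → Carrier
    state n I = remaining n (I ++ replicate n true)

    -- Of the `n + 1` trailing columns of the right-hand state, the first is the `a` that a step of
    -- `T` adjoins; the others lie beyond `a`, where the weights vanish, so they are never deleted.
    state-suc : ∀ n I → length I ≡ b ℕ.+ a →
      contract (I ++ true ∷ []) weight (shift (state n)) ≈ state (suc n) I
    state-suc n I len = begin
      contract X weight (shift (state n))
        ≈⟨ contract-congʸ X shifted ⟩
      contract X weight (λ Z → shift (remaining n) (Z ++ 1ⁿ))
        ≈⟨ +-identityʳ _ ⟨
      contract X weight (λ Z → shift (remaining n) (Z ++ 1ⁿ)) + 0#
        ≈⟨ +-congˡ (*-zeroʳ (sign (size X)) (contract-zeroWeight 1ⁿ λ i →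
             trans (reflexive (≡.cong (λ l → weight (l ℕ.+ i)) length-X)) (β-high i))) ⟨
      contract X weight (λ Z → shift (remaining n) (Z ++ 1ⁿ)) +
        sign (size X) * contract 1ⁿ (weight ∘ (length X ℕ.+_)) (λ Z → shift (remaining n) (X ++ Z))
        ≈⟨ contract-++ X 1ⁿ weight (shift (remaining n)) ⟨
      contract (X ++ 1ⁿ) weight (shift (remaining n))
        ≈⟨ reflexive (≡.cong (λ Z → contract Z weight (shift (remaining n))) (List.++-assoc I _ 1ⁿ)) ⟩
      contract (I ++ true ∷ 1ⁿ) weight (shift (remaining n)) ∎
      where
      X 1ⁿ : List Bool
      X = I ++ true ∷ []
      1ⁿ = replicate n true

      length-X : length X ≡ suc (b ℕ.+ a)
      length-X = ≡.trans (List.length-++ I) (≡.trans (ℕ.+-comm _ 1) (≡.cong suc len))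

      shifted : ∀ Z → length Z ≡ length X → suc (size Z) ≡ size X →
        shift (state n) Z ≈ shift (remaining n) (Z ++ 1ⁿ)
      shifted []          l _ = contradiction (≡.trans l length-X) ℕ.0≢1+n
      shifted (false ∷ Z) _ _ = refl
      shifted (true ∷ Z)  _ _ = refl

    private
      1ᵃ : List Bool
      1ᵃ = replicate a true

    -- A padding column once deleted stays missing: the last `a` positions remain the last ones
    -- under each shift, and the final comparison with `I₀` requires all of them.
    remaining-tail≢ : ∀ n Y Z → length Y ≡ b ℕ.+ n → length Z ≡ a → Z ≢ 1ᵃ → remaining n (Y ++ Z) ≈ 0#
    shift-remaining-tail≢ : ∀ n Y Z → length Y ≡ b ℕ.+ suc n → length Z ≡ a → Z ≢ 1ᵃ →
      shift (remaining n) (Y ++ Z) ≈ 0#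
    remaining-shrinkTail : ∀ n Y Z → length Y ≡ b ℕ.+ suc n → length Z ≡ a → ∀ w →
      contract Z w (λ Z′ → shift (remaining n) (Y ++ Z′)) ≈ 0#

    remaining-tail≢ zero Y Z lenY lenZ Z≢ = indicator-≢ {I₀-list} {Y ++ Z} λ eq → Z≢ (≡.sym (++-injectiveʳ (replicate b false) Y
      (≡.trans (List.length-replicate b) (≡.sym (≡.trans lenY (ℕ.+-identityʳ b)))) eq))
    remaining-tail≢ (suc n) Y Z lenY lenZ Z≢ = begin
      contract (Y ++ Z) weight (shift (remaining n))
        ≈⟨ contract-++ Y Z weight _ ⟩
      contract Y weight (λ Y′ → shift (remaining n) (Y′ ++ Z)) +
        sign (size Y) * contract Z _ (λ Z′ → shift (remaining n) (Y ++ Z′))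
        ≈⟨ +-cong (contract-zero Y λ Y′ len _ → shift-remaining-tail≢ n Y′ Z (≡.trans len lenY) lenZ Z≢)
                  (*-zeroʳ (sign (size Y)) (remaining-shrinkTail n Y Z lenY lenZ _)) ⟩
      0# + 0#  ≈⟨ +-identityˡ 0# ⟩
      0#       ∎

    shift-remaining-tail≢ n []          Z lenY lenZ Z≢ = contradiction (≡.trans lenY (ℕ.+-suc b n)) ℕ.0≢1+n
    shift-remaining-tail≢ n (true ∷ Y)  Z lenY lenZ Z≢ = refl
    shift-remaining-tail≢ n (false ∷ Y) Z lenY lenZ Z≢ =
      remaining-tail≢ n Y Z (ℕ.suc-injective (≡.trans lenY (ℕ.+-suc b n))) lenZ Z≢

    remaining-shrinkTail n Y Z lenY lenZ w = contract-zero Z λ Z′ len sz →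
      shift-remaining-tail≢ n Y Z′ lenY (≡.trans len lenZ) λ where
        -- If a deletion left the padding full, `Z` would have had `a + 1` elements in `a`
        -- positions.
        ≡.refl → ℕ.1+n≰n (≡.subst (suc a ℕ.≤_) lenZ
          (≡.subst (ℕ._≤ length Z) (≡.trans (≡.sym sz) (≡.cong suc (size-trues a))) (size≤length Z)))

    -- With intact padding, only deletions from `Y` survive, and these are the terms of a first-row
    -- expansion. Each shift lowers the columns by 1, which matches the row index `r` subtracted in
    -- the entries.
    remaining-det : ∀ n Y → length Y ≡ b ℕ.+ n → size Y ≡ n →
      remaining n (Y ++ 1ᵃ) ≈ det {n} (λ r c → β (nth Y (toℕ c) ⊖ (toℕ r ℕ.+ b)))
    remaining-det zero Y lenY szY = trans
      (reflexive (≡.cong (λ Z → indicator I₀-list (Z ++ 1ᵃ))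
        (≡.trans (size≡0⇒falses Y szY) (≡.cong (λ l → replicate l false) (≡.trans lenY (ℕ.+-identityʳ b))))))
      (indicator-refl I₀-list)
    remaining-det (suc n) Y lenY szY = begin
      contract (Y ++ 1ᵃ) weight (shift (remaining n))
        ≈⟨ contract-++ Y 1ᵃ weight _ ⟩
      contract Y weight Ψ + sign (size Y) * contract 1ᵃ _ (λ Z → shift (remaining n) (Y ++ Z))
        ≈⟨ +-congˡ (*-zeroʳ (sign (size Y)) (remaining-shrinkTail n Y 1ᵃ lenY (List.length-replicate a) _)) ⟩
      contract Y weight Ψ + 0#
        ≈⟨ +-identityʳ _ ⟩
      contract Y weight Ψ
        ≈⟨ laplace-columns Y szY weight Φ
             (λ f≗g → det-cong λ r c → reflexive (≡.cong (λ j → β (j ⊖ (suc (toℕ r) ℕ.+ b))) (f≗g c)))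
             Ψ Ψ≈Φ ⟨
      det {suc n} (λ r c → β (nth Y (toℕ c) ⊖ (toℕ r ℕ.+ b))) ∎
      where
      Φ : (Fin n → ℕ) → Carrier
      Φ f = det {n} λ r c → β (f c ⊖ (suc (toℕ r) ℕ.+ b))

      Ψ : List Bool → Carrier
      Ψ Y′ = shift (remaining n) (Y′ ++ 1ᵃ)

      Ψ≈Φ : ∀ Y′ → length Y′ ≡ length Y → size Y′ ≡ n → Ψ Y′ ≈ Φ (nth Y′ ∘ toℕ)
      Ψ≈Φ []           len sz = contradiction (≡.trans len (≡.trans lenY (ℕ.+-suc b n))) ℕ.0≢1+n
      Ψ≈Φ (false ∷ Y′) len sz = trans
        (remaining-det n Y′ (ℕ.suc-injective (≡.trans len (≡.trans lenY (ℕ.+-suc b n)))) sz)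
        (det-cong {n} λ r c → reflexive (≡.cong β (≡.sym (ℤ.[1+m]⊖[1+n]≡m⊖n (nth Y′ (toℕ c)) (toℕ r ℕ.+ b)))))
      -- Column `-b` was not deleted, so `shift` gives 0. The minor is 0 too: in all later rows that
      -- column lies below the band.
      Ψ≈Φ (true ∷ Y′)  len ≡.refl = sym (det-zeroColumn {size Y′}
        (λ r c → β (nth (true ∷ Y′) (toℕ c) ⊖ (suc (toℕ r) ℕ.+ b))) λ r → β-low (toℕ r))

    state-I₀ : ∀ n → state n I₀-list ≈ F n
    state-I₀ n = begin
      remaining n ((replicate b false ++ replicate a true) ++ replicate n true)
        ≈⟨ reflexive (≡.cong (remaining n) rearrange) ⟩
      remaining n (Y ++ 1ᵃ)
        ≈⟨ remaining-det n Y (≡.trans (List.length-++ (replicate b false))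
             (≡.cong₂ ℕ._+_ (List.length-replicate b) (List.length-replicate n)))
             (≡.trans (size-++ (replicate b false) _) (≡.cong₂ ℕ._+_ (size-falses b) (size-trues n))) ⟩
      det {n} (λ r c → β (nth Y (toℕ c) ⊖ (toℕ r ℕ.+ b)))
        ≈⟨ toeplitz n ⟩
      F n ∎
      where
      Y : List Bool
      Y = replicate b false ++ replicate n true

      -- The two blocks of `true` change roles: the first `n` are the columns of the matrix and the
      -- last `a` are the padding.
      rearrange : (replicate b false ++ replicate a true) ++ replicate n true ≡ Y ++ 1ᵃ
      rearrange = ≡.trans (List.++-assoc (replicate b false) _ _)
        (≡.trans (≡.cong (replicate b false ++_) (trues-comm a n)) (≡.sym (List.++-assoc (replicate b false) _ _)))
        where
        replicate-++ : ∀ m n → replicate m true ++ replicate n true ≡ replicate (m ℕ.+ n) true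
        replicate-++ zero    n = ≡.refl
        replicate-++ (suc m) n = ≡.cong (true ∷_) (replicate-++ m n)

        trues-comm : ∀ m n → replicate m true ++ replicate n true ≡ replicate n true ++ replicate m true
        trues-comm m n = ≡.trans (replicate-++ m n)
          (≡.trans (≡.cong (λ k → replicate k true) (ℕ.+-comm m n)) (≡.sym (replicate-++ n m)))

      entry : ∀ {n} (r c : Fin n) → β (toℕ c ⊖ toℕ r) ≈ δ Fin._≟_ r c - ω (toℕ c ⊖ toℕ r)
      entry r c with r Fin.≟ c
      ... | yes ≡.refl rewrite ℤ.n⊖n≡0 (toℕ r) = refl
      ... | no r≢c = +-congʳ (reflexive (≡.cong (λ d → if d then 1# else 0#)
        (dec-false ((toℕ c ⊖ toℕ r) ℤ.≟ 0ℤ) λ eq → r≢c (Fin.toℕ-injective (≡.sym (ℤ.+-injective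
          (ℤ.i-j≡0⇒i≡j (+ toℕ c) (+ toℕ r) (≡.trans (ℤ.m-n≡m⊖n (toℕ c) (toℕ r)) eq))))))))

      toeplitz : ∀ n → det {n} (λ r c → β (nth (replicate b false ++ replicate n true) (toℕ c) ⊖ (toℕ r ℕ.+ b))) ≈ F n
      toeplitz zero    = refl
      toeplitz (suc n) = det-cong {suc n} λ r c → trans
        (reflexive (≡.cong β (≡.trans
          (≡.cong₂ _⊖_ (nth-interval b (suc n) (toℕ c) (Fin.toℕ<n c)) (ℕ.+-comm (toℕ r) b))
          (ℤ.+-cancelˡ-⊖ b (toℕ c) (toℕ r)))))
        (entry r c)

-- The lowest term of the reversed cofactor.

leadingFalses : List Bool → ℕ
leadingFalses (false ∷ X) = suc (leadingFalses X)
leadingFalses _           = 0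

leadingFalses-++ : ∀ X Y → leadingFalses X ℕ.≤ leadingFalses (X ++ Y)
leadingFalses-++ []          Y = z≤n
leadingFalses-++ (false ∷ X) Y = s≤s (leadingFalses-++ X Y)
leadingFalses-++ (true ∷ X)  Y = z≤n

-- All cyclic rotations of `I₀` have this form: `x = true` serves the first `a` backward steps and
-- `x = false` the last `b`.
blocks : Bool → ℕ → ℕ → ℕ → List Bool
blocks x p m q = replicate p x ++ replicate m (not x) ++ replicate q x

replicate-snoc : ∀ n (x : Bool) → replicate n x ++ x ∷ [] ≡ x ∷ replicate n x
replicate-snoc zero    x = ≡.refl
replicate-snoc (suc n) x = ≡.cong (x ∷_) (replicate-snoc n x)

blocks-snoc : ∀ x p m q → blocks x p m q ++ x ∷ [] ≡ blocks x p m (suc q)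
blocks-snoc x p m q = ≡.trans (List.++-assoc (replicate p x) _ _)
  (≡.cong (replicate p x ++_) (≡.trans (List.++-assoc (replicate m (not x)) _ _)
    (≡.cong (replicate m (not x) ++_) (replicate-snoc q x))))

length-blocks : ∀ x p m q → length (blocks x p m q) ≡ m ℕ.+ (p ℕ.+ q)
length-blocks x (suc p) m q = ≡.trans (≡.cong suc (length-blocks x p m q)) (≡.sym (ℕ.+-suc m (p ℕ.+ q)))
length-blocks x zero    m q = ≡.trans (List.length-++ (replicate m (not x)))
  (≡.cong₂ ℕ._+_ (List.length-replicate m) (List.length-replicate q))

size-blocks-true : ∀ p m q → size (blocks true p m q) ≡ p ℕ.+ q
size-blocks-true (suc p) m q = ≡.cong suc (size-blocks-true p m q)
size-blocks-true zero    m q = ≡.trans (size-++ (replicate m false) _)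
  (≡.cong₂ ℕ._+_ (size-falses m) (size-trues q))

size-blocks-false : ∀ p m q → size (blocks false p m q) ≡ m
size-blocks-false (suc p) m q = size-blocks-false p m q
size-blocks-false zero    m q = ≡.trans (size-++ (replicate m true) _)
  (≡.trans (≡.cong₂ ℕ._+_ (size-trues m) (size-falses q)) (ℕ.+-identityʳ m))

leadingFalses-blocks : ∀ p m q → leadingFalses (blocks false p (suc m) q) ≡ p
leadingFalses-blocks zero    m q = ≡.refl
leadingFalses-blocks (suc p) m q = ≡.cong suc (leadingFalses-blocks p m q)

-- Solving  T c₀ = 0 - d₀ e,  T cₖ₊₁ = cₖ - dₖ₊₁ e  for the coefficients of the
-- reversed cofactors, where e is the indicator of I₀; here c (suc k) stands for cₖ.
-- Starting at I₀, a applications of T⁻¹ are forced to rotate [0, a-1]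
-- into [-b, -b+a-1], and b further ones are needed to move the minimum back to 0.
module Reversed {c ℓ₁ ℓ₂} (K : HeytingField c ℓ₁ ℓ₂) (w : ℕ → HeytingField.Carrier K) (a′ b′ : ℕ) where
  open FieldDeterminants K
  open CommutativeRing commRing hiding (zero)
  open HeytingField K using (_#_)
  open Determinants commRing
  open Contraction commRing
  open RingProperties ring
  open SetoidReasoning setoid

  private
    a b : ℕ
    a = suc a′
    b = suc b′

    I₀ : List Bool
    I₀ = replicate b false ++ replicate a true

    I₀-blocks : blocks false b a 0 ≡ I₀
    I₀-blocks = ≡.cong (replicate b false ++_) (List.++-identityʳ (replicate a true))

    leadingFalses-I₀ : leadingFalses I₀ ≡ b
    leadingFalses-I₀ = ≡.trans (≡.cong leadingFalses (≡.sym I₀-blocks)) (leadingFalses-blocks b a′ 0)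

    top-blocks : blocks true a b 0 ≡ blocks false 0 a b
    top-blocks = ≡.cong (replicate a true ++_) (List.++-identityʳ (replicate b false))

  module _ (w-bottom : w 0 # 0#) (w-top : w (b ℕ.+ a) # 0#)
           (cᵏ : ℕ → List Bool → Carrier) (d : ℕ → Carrier) (c₀≈0 : ∀ L → cᵏ 0 L ≈ 0#) (d₀#0 : d 0 # 0#)
           (solves : ∀ k L → length L ≡ b ℕ.+ a → size L ≡ a →
             contract (L ++ true ∷ []) w (shift (cᵏ (suc k))) ≈ cᵏ k L - d k * indicator I₀ L) where

    private
      x-y0≈x : ∀ x y → x - y * 0# ≈ x
      x-y0≈x x y = trans (+-congˡ (trans (-‿cong (zeroʳ y)) -0#≈0#)) (+-identityʳ x)

      -- The row has the single entry of `contract-inside`, and the source term is absent because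
      -- `I₀` starts with `false`.
      inside-step : ∀ k L → length L ≡ b′ ℕ.+ a → suc (size L) ≡ a →
        w 0 * cᵏ (suc k) (L ++ true ∷ []) ≈ cᵏ k (true ∷ L)
      inside-step k L len sz = begin
        w 0 * cᵏ (suc k) (L ++ true ∷ [])
          ≈⟨ contract-inside L w (cᵏ (suc k)) ⟨
        contract (true ∷ L ++ true ∷ []) w (shift (cᵏ (suc k)))
          ≈⟨ solves k (true ∷ L) (≡.cong suc len) sz ⟩
        cᵏ k (true ∷ L) - d k * 0#
          ≈⟨ x-y0≈x _ _ ⟩
        cᵏ k (true ∷ L) ∎

      -- One step back moves the last position to the front and so adds at most one leading `false`.
      -- The source sits at `I₀`, which has `b` of them, so under this bound the index reaches 0
      -- before the source is met.
      leadingFalses-vanish : ∀ k L → length L ≡ b ℕ.+ a → size L ≡ a →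
        leadingFalses L ℕ.+ k ℕ.< b → cᵏ k L ≈ 0#

      ending-inside-vanish : ∀ k L → k ℕ.< b → length L ≡ b′ ℕ.+ a → suc (size L) ≡ a →
        cᵏ (suc k) (L ++ true ∷ []) ≈ 0#

      -- The other entries of the row lead to sets ending with `a - 1`, where `ending-inside-vanish`
      -- applies while `k < b`. Only the rotation is left.
      outside-step : ∀ k L → k ℕ.< b → length L ≡ b′ ℕ.+ a → size L ≡ a →
        (sign a * w (b ℕ.+ a)) * cᵏ (suc k) (L ++ false ∷ []) ≈ cᵏ k (false ∷ L) - d k * indicator I₀ (false ∷ L)

      ending-inside-vanish k L k<b len sz = *-cancel-#0 w-bottom (trans (inside-step k L len sz)
        (leadingFalses-vanish k (true ∷ L) (≡.cong suc len) sz k<b))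

      outside-step k L k<b len sz = begin
        (sign a * w (b ℕ.+ a)) * y (L ++ false ∷ [])
          ≈⟨ *-assoc _ _ _ ⟩
        sign a * (w (b ℕ.+ a) * y (L ++ false ∷ []))
          ≈⟨ reflexive (≡.cong₂ (λ n l → sign n * (w (suc l) * y (L ++ false ∷ []))) (≡.sym sz) (≡.sym len)) ⟩
        sign (size L) * (w (suc (length L)) * y (L ++ false ∷ []))
          ≈⟨ +-identityˡ _ ⟨
        0# + sign (size L) * (w (suc (length L)) * y (L ++ false ∷ []))
          ≈⟨ +-congʳ (contract-zero L λ Z lenZ szZ →
               ending-inside-vanish k Z k<b (≡.trans lenZ len) (≡.trans szZ sz)) ⟨
        contract L (w ∘ suc) (λ Z → y (Z ++ true ∷ [])) + sign (size L) * (w (suc (length L)) * y (L ++ false ∷ []))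
          ≈⟨ contract-outside L w y ⟨
        contract (false ∷ L ++ true ∷ []) w (shift y)
          ≈⟨ solves k (false ∷ L) (≡.cong suc len) sz ⟩
        cᵏ k (false ∷ L) - d k * indicator I₀ (false ∷ L) ∎
        where y = cᵏ (suc k)

      κ#0 : sign a * w (b ℕ.+ a) # 0#
      κ#0 = x#0y#0→xy#0 (sign#0 a) w-top

      leadingFalses-vanish zero    L len sz lt = c₀≈0 L
      leadingFalses-vanish (suc k) L len sz lt with initLast L
      ... | I ∷ʳ′ true  = ending-inside-vanish k I (ℕ.m+n≤o⇒n≤o (leadingFalses (I ++ true ∷ [])) (ℕ.≤-trans (ℕ.n≤1+n _) lt))
        (ℕ.suc-injective (≡.trans (≡.sym (≡.trans (List.length-++ I) (ℕ.+-comm _ 1))) len))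
        (≡.trans (≡.sym (≡.trans (size-++ I _) (ℕ.+-comm _ 1))) sz)
      ... | I ∷ʳ′ false = *-cancel-#0 κ#0 (begin
        (sign a * w (b ℕ.+ a)) * cᵏ (suc k) (I ++ false ∷ [])
          ≈⟨ outside-step k I k<b lenI szI ⟩
        cᵏ k (false ∷ I) - d k * indicator I₀ (false ∷ I)
          ≈⟨ +-cong (leadingFalses-vanish k (false ∷ I) (≡.cong suc lenI) szI lt′)
               (-‿cong (*-zeroʳ (d k) (indicator-≢ I₀≢))) ⟩
        0# - 0#  ≈⟨ -‿inverseʳ 0# ⟩
        0#       ∎)
        where
        k<b : k ℕ.< b
        k<b = ℕ.m+n≤o⇒n≤o (leadingFalses (I ++ false ∷ [])) (ℕ.≤-trans (ℕ.n≤1+n _) lt)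
        lenI : length I ≡ b′ ℕ.+ a
        lenI = ℕ.suc-injective (≡.trans (≡.sym (≡.trans (List.length-++ I) (ℕ.+-comm _ 1))) len)
        szI : size I ≡ a
        szI = ≡.trans (≡.sym (≡.trans (size-++ I _) (ℕ.+-identityʳ _))) sz
        lt′ : suc (leadingFalses I) ℕ.+ k ℕ.< b
        lt′ = ℕ.≤-trans (s≤s (ℕ.≤-trans (s≤s (ℕ.+-monoˡ-≤ k (leadingFalses-++ I (false ∷ []))))
                (ℕ.≤-reflexive (≡.sym (ℕ.+-suc (leadingFalses (I ++ false ∷ [])) k))))) lt
        I₀≢ : I₀ ≢ false ∷ I
        I₀≢ eq = ℕ.<-irrefl (≡.trans (≡.cong leadingFalses (≡.sym eq)) leadingFalses-I₀)
          (ℕ.≤-<-trans (ℕ.m≤m+n (leadingFalses (false ∷ I)) k) lt′)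

      inside-step-blocks : ∀ k q r → suc q ℕ.+ r ≡ a →
        w 0 * cᵏ (suc k) (blocks true q b (suc r)) ≈ cᵏ k (blocks true (suc q) b r)
      inside-step-blocks k q r eq = trans
        (reflexive (≡.cong (λ L → w 0 * cᵏ (suc k) L) (≡.sym (blocks-snoc true q b r))))
        (inside-step k (blocks true q b r)
          (≡.trans (length-blocks true q b r) (≡.trans (≡.sym (ℕ.+-suc b′ (q ℕ.+ r))) (≡.cong (b′ ℕ.+_) eq)))
          (≡.trans (≡.cong suc (size-blocks-true q b r)) eq))

      -- Each step moves one of the `r` trailing elements to the front, so the index reaches 0 while
      -- the steps are still forced.
      early-vanish : ∀ k q r → q ℕ.+ r ≡ a → k ℕ.≤ r → cᵏ k (blocks true q b r) ≈ 0#
      early-vanish zero    q r       eq k≤r       = c₀≈0 _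
      early-vanish (suc k) q (suc r) eq (s≤s k≤r) = *-cancel-#0 w-bottom
        (trans (inside-step-blocks k q r eq′) (early-vanish k (suc q) r eq′ k≤r))
        where eq′ = ≡.trans (≡.sym (ℕ.+-suc q r)) eq

      rotate-vanish : ∀ k q r → q ℕ.+ r ≡ a → cᵏ k (blocks true a b 0) ≈ 0# →
        cᵏ (r ℕ.+ k) (blocks true q b r) ≈ 0#
      rotate-vanish k q zero eq c≈0 =
        trans (reflexive (≡.cong (λ q → cᵏ k (blocks true q b 0)) (≡.trans (≡.sym (ℕ.+-identityʳ q)) eq))) c≈0
      rotate-vanish k q (suc r) eq c≈0 = *-cancel-#0 w-bottom
        (trans (inside-step-blocks (r ℕ.+ k) q r eq′) (rotate-vanish k (suc q) r eq′ c≈0))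
        where eq′ = ≡.trans (≡.sym (ℕ.+-suc q r)) eq

      rotate-#0 : ∀ k q r → q ℕ.+ r ≡ a → cᵏ k (blocks true a b 0) # 0# →
        cᵏ (r ℕ.+ k) (blocks true q b r) # 0#
      rotate-#0 k q zero eq c#0 =
        #-congʳ (reflexive (≡.cong (λ q → cᵏ k (blocks true q b 0)) (≡.sym (≡.trans (≡.sym (ℕ.+-identityʳ q)) eq)))) c#0
      rotate-#0 k q (suc r) eq c#0 = factor-#0
        (#-congʳ (sym (inside-step-blocks (r ℕ.+ k) q r eq′)) (rotate-#0 k (suc q) r eq′ c#0))
        where eq′ = ≡.trans (≡.sym (ℕ.+-suc q r)) eq

      outside-step-blocks : ∀ k p q → suc p ℕ.+ q ≡ b → k ℕ.< b →
        (sign a * w (b ℕ.+ a)) * cᵏ (suc k) (blocks false p a (suc q)) ≈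
        cᵏ k (blocks false (suc p) a q) - d k * indicator I₀ (blocks false (suc p) a q)
      outside-step-blocks k p q eq k<b = trans
        (reflexive (≡.cong (λ L → (sign a * w (b ℕ.+ a)) * cᵏ (suc k) L) (≡.sym (blocks-snoc false p a q))))
        (outside-step k (blocks false p a q) k<b
          (≡.trans (length-blocks false p a q) (≡.trans (ℕ.+-comm a (p ℕ.+ q)) (≡.cong (ℕ._+ a) (ℕ.suc-injective eq))))
          (size-blocks-false p a q))

      I₀≢blocks : ∀ p q → suc p ℕ.+ suc q ≡ b → I₀ ≢ blocks false (suc p) a (suc q)
      I₀≢blocks p q eq I₀≡ = ℕ.m≢1+m+n (suc p) (≡.trans
        (≡.sym (≡.trans (≡.cong leadingFalses I₀≡) (leadingFalses-blocks (suc p) a′ (suc q))))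
        (≡.trans leadingFalses-I₀ (≡.trans (≡.sym eq) (ℕ.+-suc (suc p) q))))

      -- The source enters only at `I₀`, which is `q` rotations away; with `k < q` the index runs
      -- out first.
      late-vanish : ∀ k p q → p ℕ.+ q ≡ b → k ℕ.< q → cᵏ k (blocks false p a q) ≈ 0#
      late-vanish zero    p q             eq lt = c₀≈0 _
      late-vanish (suc k) p (suc (suc q)) eq (s≤s lt) = *-cancel-#0 κ#0 (begin
        (sign a * w (b ℕ.+ a)) * cᵏ (suc k) (blocks false p a (suc (suc q)))
          ≈⟨ outside-step-blocks k p (suc q) eq′ (ℕ.<-≤-trans lt (ℕ.m+n≤o⇒n≤o (suc p) (ℕ.≤-reflexive eq′))) ⟩
        cᵏ k (blocks false (suc p) a (suc q)) - d k * indicator I₀ (blocks false (suc p) a (suc q))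
          ≈⟨ +-cong (late-vanish k (suc p) (suc q) eq′ lt) (-‿cong (*-zeroʳ (d k) (indicator-≢ (I₀≢blocks p q eq′)))) ⟩
        0# - 0#  ≈⟨ -‿inverseʳ 0# ⟩
        0#       ∎)
        where eq′ = ≡.trans (≡.sym (ℕ.+-suc p (suc q))) eq

      -- Here the last rotation reaches `I₀` exactly when the index reaches 0, so the value is `d 0`
      -- up to an invertible factor.
      late-#0 : ∀ p q → p ℕ.+ suc q ≡ b → cᵏ (suc q) (blocks false p a (suc q)) # 0#
      late-#0 p zero eq = factor-#0 (#-congʳ (sym first-step) (x#0y#0→xy#0 -1#0 d₀#0))
        where
        eq′ : suc p ℕ.+ 0 ≡ b
        eq′ = ≡.trans (≡.sym (ℕ.+-suc p 0)) eq
        blocks≡I₀ : blocks false (suc p) a 0 ≡ I₀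
        blocks≡I₀ = ≡.trans (≡.cong (λ p → blocks false p a 0) (≡.trans (≡.sym (ℕ.+-identityʳ (suc p))) eq′)) I₀-blocks
        first-step : (sign a * w (b ℕ.+ a)) * cᵏ 1 (blocks false p a 1) ≈ - 1# * d 0
        first-step = begin
          (sign a * w (b ℕ.+ a)) * cᵏ 1 (blocks false p a 1)
            ≈⟨ outside-step-blocks 0 p 0 eq′ (s≤s z≤n) ⟩
          cᵏ 0 (blocks false (suc p) a 0) - d 0 * indicator I₀ (blocks false (suc p) a 0)
            ≈⟨ +-cong (c₀≈0 _) (-‿cong (*-congˡ (trans (reflexive (≡.cong (indicator I₀) blocks≡I₀)) (indicator-refl I₀)))) ⟩
          0# - d 0 * 1#   ≈⟨ +-identityˡ _ ⟩
          - (d 0 * 1#)    ≈⟨ -‿cong (*-identityʳ _) ⟩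
          - d 0           ≈⟨ -1*x≈-x (d 0) ⟨
          - 1# * d 0      ∎
      late-#0 p (suc q) eq = factor-#0 (#-congʳ (sym next-step) (late-#0 (suc p) q eq′))
        where
        eq′ : suc p ℕ.+ suc q ≡ b
        eq′ = ≡.trans (≡.sym (ℕ.+-suc p (suc q))) eq
        next-step : (sign a * w (b ℕ.+ a)) * cᵏ (suc (suc q)) (blocks false p a (suc (suc q))) ≈
          cᵏ (suc q) (blocks false (suc p) a (suc q))
        next-step = begin
          (sign a * w (b ℕ.+ a)) * cᵏ (suc (suc q)) (blocks false p a (suc (suc q)))
            ≈⟨ outside-step-blocks (suc q) p (suc q) eq′ (ℕ.m+n≤o⇒n≤o p (ℕ.≤-reflexive eq)) ⟩
          cᵏ (suc q) (blocks false (suc p) a (suc q)) - d (suc q) * indicator I₀ (blocks false (suc p) a (suc q))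
            ≈⟨ +-congˡ (-‿cong (*-congˡ (indicator-≢ (I₀≢blocks p q eq′)))) ⟩
          cᵏ (suc q) (blocks false (suc p) a (suc q)) - d (suc q) * 0#
            ≈⟨ x-y0≈x _ _ ⟩
          cᵏ (suc q) (blocks false (suc p) a (suc q)) ∎

    low-coefficients : ∀ k → k ℕ.< a ℕ.+ b → cᵏ k I₀ ≈ 0#
    low-coefficients k k<a+b with ℕ.≤-total k a
    ... | inj₁ k≤a = early-vanish k 0 a ≡.refl k≤a
    ... | inj₂ a≤k = ≡.subst (λ k → cᵏ k I₀ ≈ 0#) (ℕ.m+[n∸m]≡n a≤k)
      (rotate-vanish (k ℕ.∸ a) 0 a ≡.refl
        (trans (reflexive (≡.cong (cᵏ (k ℕ.∸ a)) top-blocks))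
          (late-vanish (k ℕ.∸ a) 0 b ≡.refl
            (ℕ.+-cancelˡ-< a (k ℕ.∸ a) b (≡.subst (ℕ._< a ℕ.+ b) (≡.sym (ℕ.m+[n∸m]≡n a≤k)) k<a+b)))))

    lowest-coefficient : cᵏ (a ℕ.+ b) I₀ # 0#
    lowest-coefficient = rotate-#0 b 0 a ≡.refl
      (#-congʳ (reflexive (≡.cong (cᵏ b) (≡.sym top-blocks))) (late-#0 0 b′ ≡.refl))

-- Cofactor equations for matrices with entries linear in `z`.

module LinearMatrices {c ℓ} (R : CommutativeRing c ℓ) where
  open CommutativeRing R hiding (zero)
  open FormalPowerSeries R
  open PowerSeries rawRing using (const; var)
  open Determinants R using (sum-cong)
  open Matrices rawRing
  open SemiringSum semiring
  open SetoidReasoning setoid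
  private
    module DS = Determinants commutativeRing

  basis : ∀ {m} → Fin (suc m) → Carrier
  basis zero    = 1#
  basis (suc _) = 0#

  var-*-zero : ∀ f → (var S.* f) 0 ≈ 0#
  var-*-zero f = trans (+-identityʳ _) (zeroˡ _)

  var-*-suc : ∀ f n → (var S.* f) (suc n) ≈ f n
  var-*-suc f n = begin
    0# * f (suc n) + (tail var S.* f) n  ≈⟨ +-cong (zeroˡ _) (SR.*-cong {x = tail var} {const 1#} {f} tail-var (λ _ → refl) n) ⟩
    0# + (const 1# S.* f) n              ≈⟨ +-identityˡ _ ⟩
    (const 1# S.* f) n                   ≈⟨ const-* 1# f n ⟩
    1# * f n                             ≈⟨ *-identityˡ _ ⟩
    f n                                  ∎
    where
    tail-var : tail var S.≈ const 1#
    tail-var zero    = refl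
    tail-var (suc n) = refl

  module _ {m} (P Q : Matrix (Fin (suc m))) where
    linearMatrix : Mz.Matrix (Fin (suc m))
    linearMatrix r c = linear (P r c) (Q r c)

    private
      adj : Fin (suc m) → Series
      adj = DS.cofactor linearMatrix

      row : ∀ i n → sum (λ j → (linearMatrix i j S.* adj j) n) ≈ basis i * Mz.det linearMatrix n
      row i n = trans (sym (sum-coefficient (λ j → linearMatrix i j S.* adj j) n)) (total i)
        where
        total : ∀ i → Ssum (λ j → linearMatrix i j S.* adj j) n ≈ basis i * Mz.det linearMatrix n
        total zero    = trans (DS.firstRow∙cofactor linearMatrix n) (sym (*-identityˡ _))
        total (suc i) = trans (DS.otherRow∙cofactor linearMatrix i n) (trans (const0 n) (sym (zeroˡ _)))

    -- With `linear∙cofactor-suc`, this compares coefficients in `(P + z Q) adj = det * e`, a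
    -- recursion that serves `1 - zT` and `z - T` alike.
    linear∙cofactor-zero : ∀ i → sum (λ j → P i j * adj j 0) ≈ basis i * Mz.det linearMatrix 0
    linear∙cofactor-zero i = trans (sum-cong {suc m} λ j → sym (linear-* (P i j) (Q i j) (adj j) 0)) (row i 0)

    linear∙cofactor-suc : ∀ i n →
      sum (λ j → P i j * adj j (suc n)) + sum (λ j → Q i j * adj j n) ≈ basis i * Mz.det linearMatrix (suc n)
    linear∙cofactor-suc i n = begin
      sum (λ j → P i j * adj j (suc n)) + sum (λ j → Q i j * adj j n)
        ≈⟨ ∑-distrib-+ (λ j → P i j * adj j (suc n)) (λ j → Q i j * adj j n) ⟨
      sum (λ j → P i j * adj j (suc n) + Q i j * adj j n)
        ≈⟨ sum-cong {suc m} (λ j → linear-* (P i j) (Q i j) (adj j) (suc n)) ⟨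
      sum (λ j → (linearMatrix i j S.* adj j) (suc n))
        ≈⟨ row i (suc n) ⟩
      basis i * Mz.det linearMatrix (suc n) ∎

module _ {c ℓ₁ ℓ₂} (K : HeytingField c ℓ₁ ℓ₂) where
  open FieldDeterminants K
  open FormalPowerSeries commRing

  invertible-#0 : ∀ f → HeytingField._#_ K (f 0) (HeytingField.0# K) → Invertible S._≈_ S.1# S._*_ f
  invertible-#0 f f₀#0 with HeytingField.#⇒invertible K f₀#0
  ... | u , u*f₀≈1 , _ = invertible f u (trans (*-congˡ (sym (x-0≈x (f 0)))) u*f₀≈1)
    where open CommutativeRing commRing

-- The generating function and the two degrees.

module Main {c ℓ₁ ℓ₂} (K : HeytingField c ℓ₁ ℓ₂)
            (ω : ℤ → HeytingField.Carrier K) (a′ b′ : ℕ) where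
  a b : ℕ
  a = suc a′
  b = suc b′

  open Weighted K ω a b
  open FieldDeterminants K
  open HeytingField K using (_#_)
  open CommutativeRing commRing hiding (zero; -_)
  open CommutativeRing commRing using () renaming (-_ to infix 8 ~_)
  open FormalPowerSeries commRing
  open PowerSeries rawRing using (const; var)
  open Determinants commRing
  open Contraction commRing
  open Matrices rawRing
  open LinearMatrices commRing
  open Transfer K ω a b
  open RingProperties ring
  open SemiringSum semiring
  open SetoidReasoning setoid
  open CommutativeSemigroupProperties *-commutativeSemigroup using (x∙yz≈y∙xz)
  private
    module DS = Determinants commutativeRing

  rest : List Index
  rest = proj₁ (subsetsOfSize-head b a)

  indices≡ : indices ≡ I₀ ∷ rest
  indices≡ = proj₂ (subsetsOfSize-head b a)

  m : ℕ
  m = length rest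

  J : Fin (suc m) → Index
  J = lookup (I₀ ∷ rest)

  unique : Unique (I₀ ∷ rest)
  unique = ≡.subst Unique indices≡ (subsetsOfSize-unique (b ℕ.+ a) a)

  J-injective : Injective _≡_ _≡_ J
  J-injective = lookup-injective unique

  ∣J∣ : ∀ j → ∣ J j ∣ ≡ a
  ∣J∣ j = proj₂ (∈.∈-filter⁻ (λ I → ∣ I ∣ ℕ.≟ a) {xs = allSubsets (b ℕ.+ a)}
    (≡.subst (J j ∈_) (≡.sym indices≡) (∈.∈-lookup j)))

  J-surjective : ∀ I → ∣ I ∣ ≡ a → ∃ λ j → J j ≡ I
  J-surjective I ∣I∣≡a = index I∈ , ≡.sym (Any.lookup-index I∈)
    where
    I∈ : I ∈ I₀ ∷ rest
    I∈ = ≡.subst (I ∈_) indices≡ (∈.∈-filter⁺ (λ I → ∣ I ∣ ℕ.≟ a) (∈-allSubsets I) ∣I∣≡a)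

  open Enumerated J J-injective ∣J∣ J-surjective

  P Q : Matrix (Fin (suc m))
  P i j = δ _≟ˢ_ (J i) (J j)
  Q i j = ~ T (J i) (J j)

  P-diagonal : ∀ i → P i i ≈ 1#
  P-diagonal i = reflexive (≡.cong (λ d → if d then 1# else 0#) (dec-true (J i ≟ˢ J i) ≡.refl))

  P-offDiagonal : ∀ i j → j ≢ i → P i j ≈ 0#
  P-offDiagonal i j j≢i = reflexive
    (≡.cong (λ d → if d then 1# else 0#) (dec-false (J i ≟ˢ J j) (j≢i ∘ ≡.sym ∘ J-injective)))

  P-sum : ∀ i (v : Fin (suc m) → Carrier) → sum (λ j → P i j * v j) ≈ v i
  P-sum i v = begin
    sum (λ j → P i j * v j)
      ≈⟨ sum-single (λ j → P i j * v j) i (λ j j≢i → *-zeroˡ (v j) (P-offDiagonal i j j≢i)) ⟩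
    P i i * v i  ≈⟨ *-congʳ (P-diagonal i) ⟩
    1# * v i     ≈⟨ *-identityˡ _ ⟩
    v i          ∎

  Q-sum : ∀ i (v : Fin (suc m) → Carrier) → sum (λ j → Q i j * v j) ≈ ~ sum (λ j → T (J i) (J j) * v j)
  Q-sum i v = trans (sum-cong {suc m} λ j → sym (-‿distribˡ-* (T (J i) (J j)) (v j)))
    (sum-neg (λ j → T (J i) (J j) * v j))

  1-zT≈linear : ∀ i j → 1-zT (J i) (J j) S.≈ linear (P i j) (Q i j)
  1-zT≈linear i j = entry (does (J i ≟ˢ J j)) (T (J i) (J j))
    where
    entry : ∀ d t n → (if d then S.1# else S.0#) n - (var S.* const t) n ≈
                      linear (if d then 1# else 0#) (~ t) n
    entry d t zero = begin
      (if d then S.1# else S.0#) 0 - (var S.* const t) 0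
        ≈⟨ +-cong (reflexive (constant d)) (trans (-‿cong (var-*-zero (const t))) -0#≈0#) ⟩
      (if d then 1# else 0#) + 0#
        ≈⟨ +-identityʳ _ ⟩
      (if d then 1# else 0#) ∎
      where
      constant : ∀ d → (if d then S.1# else S.0#) 0 ≡ (if d then 1# else 0#)
      constant false = ≡.refl
      constant true  = ≡.refl
    entry d t (suc n) = begin
      (if d then S.1# else S.0#) (suc n) - (var S.* const t) (suc n)
        ≈⟨ +-cong (reflexive (higher d)) (-‿cong (var-*-suc (const t) n)) ⟩
      0# - const t n   ≈⟨ +-identityˡ _ ⟩
      ~ const t n      ≈⟨ coefficient n ⟩
      linear (if d then 1# else 0#) (~ t) (suc n) ∎
      where
      higher : ∀ d → (if d then S.1# else S.0#) (suc n) ≡ 0#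
      higher false = ≡.refl
      higher true  = ≡.refl
      coefficient : ∀ n → ~ const t n ≈ linear (if d then 1# else 0#) (~ t) (suc n)
      coefficient zero    = refl
      coefficient (suc n) = -0#≈0#

  -- M is 1 - zT and Mʳ is z - T.
  M Mʳ : Mz.Matrix (Fin (suc m))
  M  = linearMatrix P Q
  Mʳ = linearMatrix Q P

  adj adjʳ : Fin (suc m) → Series
  adj  = DS.cofactor M
  adjʳ = DS.cofactor Mʳ

  minor₀ minor₀ʳ : Mz.Matrix (Fin m)
  minor₀  = DS.minor M zero
  minor₀ʳ = DS.minor Mʳ zero

  D≈ : D S.≈ Mz.det M
  D≈ n = trans (reflexive (≡.cong (λ is → Mz.detOver is 1-zT n) indices≡))
    (DS.det-cong 1-zT≈linear n)

  N≈ : N S.≈ Mz.det minor₀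
  N≈ n = trans (reflexive (≡.cong (λ is → Mz.detOver is 1-zT n) (≡.trans
      (≡.cong (filter (λ I → ¬? (I ≟ˢ I₀))) indices≡) (filter-≢-head unique))))
    (DS.det-cong (λ r c → 1-zT≈linear (suc r) (suc c)) n)

  adj-zero : adj zero S.≈ Mz.det minor₀
  adj-zero = SR.*-identityˡ (Mz.det minor₀)

  adjʳ-zero : adjʳ zero S.≈ Mz.det minor₀ʳ
  adjʳ-zero = SR.*-identityˡ (Mz.det minor₀ʳ)

  I₀-list≡ : list zero ≡ I₀-list
  I₀-list≡ = toList-interval b a

  basis≈indicator : ∀ i → basis i ≈ indicator I₀-list (list i)
  basis≈indicator zero    = sym (trans (reflexive (≡.cong (indicator I₀-list) I₀-list≡)) (indicator-refl I₀-list))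
  basis≈indicator (suc i) = sym (indicator-≢ λ eq → zero≢suc (J-injective
    (toList-injective (≡.trans I₀-list≡ eq))))
    where
    zero≢suc : ∀ {n} {i : Fin n} → zero ≡ suc i → _
    zero≢suc ()

  module _ (β-high : ∀ i → β ((suc (b ℕ.+ a) ℕ.+ i) ⊖ b) ≈ 0#)
           (β-low : ∀ r → β (0 ⊖ suc (r ℕ.+ b)) ≈ 0#) where
    open Banded β-high β-low

    states : Fin (suc m) → Series
    states j n = state n (list j)

    -- Both sides obey the same recursion: the coefficient at `n + 1` is `T` applied to that at `n`,
    -- plus the coefficient of `det M` times the unit vector. For the product this holds because `T`
    -- has constant entries and `T` takes `state l` to `state (suc l)`.
    adj≈ : ∀ n i → adj i n ≈ (Mz.det M S.* states i) n
    adj≈ zero i = begin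
      adj i 0                      ≈⟨ P-sum i (λ j → adj j 0) ⟨
      sum (λ j → P i j * adj j 0)  ≈⟨ linear∙cofactor-zero P Q i ⟩
      basis i * Mz.det M 0         ≈⟨ *-comm _ _ ⟩
      Mz.det M 0 * basis i         ≈⟨ *-congˡ (trans (basis≈indicator i) (reflexive (≡.cong (indicator I₀-list) (≡.sym (List.++-identityʳ (list i)))))) ⟩
      Mz.det M 0 * states i 0      ≈⟨ +-identityʳ _ ⟨
      (Mz.det M S.* states i) 0    ∎
    adj≈ (suc n) i = begin
      adj i (suc n)
        ≈⟨ P-sum i (λ j → adj j (suc n)) ⟨
      p                           ≈⟨ +-identityʳ p ⟨
      p + 0#                      ≈⟨ +-congˡ (-‿inverseˡ t) ⟨
      p + (~ t + t)               ≈⟨ +-assoc _ _ _ ⟨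
      (p - t) + t                 ≈⟨ +-cong (+-congˡ (sym (Q-sum i (λ j → adj j n)))) T-step ⟩
      (p + sum (λ j → Q i j * adj j n)) + (Mz.det M S.* tail (states i)) n
        ≈⟨ +-congʳ (linear∙cofactor-suc P Q i n) ⟩
      basis i * Mz.det M (suc n) + (Mz.det M S.* tail (states i)) n
        ≈⟨ +-congʳ (trans (*-comm _ _) (*-congˡ (trans (basis≈indicator i) (reflexive (≡.cong (indicator I₀-list) (≡.sym (List.++-identityʳ (list i)))))))) ⟩
      Mz.det M (suc n) * states i 0 + (Mz.det M S.* tail (states i)) n
        ≈⟨ *-suc (Mz.det M) (states i) n ⟨
      (Mz.det M S.* states i) (suc n) ∎
      where
      p t : Carrier
      p = sum (λ j → P i j * adj j (suc n))
      t = sum (λ j → T (J i) (J j) * adj j n)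

      T-step : t ≈ (Mz.det M S.* tail (states i)) n
      T-step = begin
        sum (λ j → T (J i) (J j) * adj j n)
          ≈⟨ sum-cong {suc m} (λ j → *-congˡ {T (J i) (J j)} (adj≈ n j)) ⟩
        sum (λ j → T (J i) (J j) * (Mz.det M S.* states j) n)
          ≈⟨ sum-cong {suc m} (λ j → *-distribˡ-sum {suc n} (T (J i) (J j)) (λ k → Mz.det M (toℕ k) * state (n ℕ.∸ toℕ k) (list j))) ⟩
        sum (λ j → sum {suc n} λ k → T (J i) (J j) * (Mz.det M (toℕ k) * state (n ℕ.∸ toℕ k) (list j)))
          ≈⟨ ∑-comm {suc m} {suc n} (λ j k → T (J i) (J j) * (Mz.det M (toℕ k) * state (n ℕ.∸ toℕ k) (list j))) ⟩
        sum {suc n} (λ k → sum λ j → T (J i) (J j) * (Mz.det M (toℕ k) * state (n ℕ.∸ toℕ k) (list j)))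
          ≈⟨ sum-cong {suc n} (λ k → advance (Mz.det M (toℕ k)) (n ℕ.∸ toℕ k)) ⟩
        sum {suc n} (λ k → Mz.det M (toℕ k) * state (suc (n ℕ.∸ toℕ k)) (list i)) ∎
        where
        advance : ∀ x l → sum (λ j → T (J i) (J j) * (x * state l (list j))) ≈ x * state (suc l) (list i)
        advance x l = begin
          sum (λ j → T (J i) (J j) * (x * state l (list j)))
            ≈⟨ sum-cong {suc m} (λ j → x∙yz≈y∙xz (T (J i) (J j)) x (state l (list j))) ⟩
          sum (λ j → x * (T (J i) (J j) * state l (list j)))
            ≈⟨ *-distribˡ-sum {suc m} x (λ j → T (J i) (J j) * state l (list j)) ⟨
          x * sum (λ j → T (J i) (J j) * state l (list j))
            ≈⟨ *-congˡ (trans (T-action-restrict i (state l)) (state-suc l (list i) (proj₁ (list-admissible i)))) ⟩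
          x * state (suc l) (list i) ∎

    N≈D*F : N S.≈ (D S.* F)
    N≈D*F n = begin
      N n                             ≈⟨ N≈ n ⟩
      Mz.det minor₀ n                 ≈⟨ adj-zero n ⟨
      adj zero n                      ≈⟨ adj≈ n zero ⟩
      (Mz.det M S.* states zero) n    ≈⟨ SR.*-cong {x = Mz.det M} {D} {states zero} {F} (λ k → sym (D≈ k))
                                           (λ k → trans (reflexive (≡.cong (state k) I₀-list≡)) (state-I₀ k)) n ⟩
      (D S.* F) n                     ∎

  module _ (w-bottom : weight 0 # 0#) (w-top : weight (b ℕ.+ a) # 0#) where

    T-entry : ∀ r c → T (J r) (J c) ≈ contract (list r ++ true ∷ []) weight (shift (indicator (list c)))
    T-entry r c = trans (T≈contract (J r) (J c) (≡.trans (∣J∣ r) (≡.sym (∣J∣ c))))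
      (contract-congʸ (list r ++ true ∷ []) λ Z _ _ → indicator-shift (list c) Z)

    T-inside : ∀ r c {I} → J r ≡ inside Vec.∷ I →
      T (J r) (J c) ≈ weight 0 * indicator (list c) (Vec.toList I ++ true ∷ [])
    T-inside r c {I} eq = begin
      T (J r) (J c)
        ≈⟨ T-entry r c ⟩
      contract (list r ++ true ∷ []) weight (shift (indicator (list c)))
        ≈⟨ reflexive (≡.cong (λ X → contract (Vec.toList X ++ true ∷ []) weight (shift (indicator (list c)))) eq) ⟩
      contract (true ∷ Vec.toList I ++ true ∷ []) weight (shift (indicator (list c)))
        ≈⟨ contract-inside (Vec.toList I) weight (indicator (list c)) ⟩
      weight 0 * indicator (list c) (Vec.toList I ++ true ∷ []) ∎

    -- If the column subset omits `a - 1`, then `J + 1` omits `a`, which forces `s = a`.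
    T-outside : ∀ r c {I I′} → J r ≡ outside Vec.∷ I → J c ≡ I′ Vec.∷ʳ outside →
      T (J r) (J c) ≈ sign (size (Vec.toList I)) * (weight (b ℕ.+ a) * indicator (list c) (Vec.toList I ++ false ∷ []))
    T-outside r c {I} {I′} eqr eqc = begin
      T (J r) (J c)
        ≈⟨ T-entry r c ⟩
      contract (list r ++ true ∷ []) weight (shift y)
        ≈⟨ reflexive (≡.cong (λ X → contract (Vec.toList X ++ true ∷ []) weight (shift y)) eqr) ⟩
      contract (false ∷ Vec.toList I ++ true ∷ []) weight (shift y)
        ≈⟨ contract-outside (Vec.toList I) weight y ⟩
      contract (Vec.toList I) (weight ∘ suc) (λ Z → y (Z ++ true ∷ [])) +
        sign (size (Vec.toList I)) * (weight (suc (length (Vec.toList I))) * y (Vec.toList I ++ false ∷ []))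
        ≈⟨ +-cong (contract-zero (Vec.toList I) λ Z _ _ → indicator-≢ (ends≢ Z))
             (reflexive (≡.cong (λ l → sign (size (Vec.toList I)) * (weight (suc l) * y (Vec.toList I ++ false ∷ [])))
               (Vec.length-toList I))) ⟩
      0# + sign (size (Vec.toList I)) * (weight (b ℕ.+ a) * y (Vec.toList I ++ false ∷ []))
        ≈⟨ +-identityˡ _ ⟩
      sign (size (Vec.toList I)) * (weight (b ℕ.+ a) * y (Vec.toList I ++ false ∷ [])) ∎
      where
      y : List Bool → Carrier
      y = indicator (list c)
      ends≢ : ∀ Z → list c ≢ Z ++ true ∷ []
      ends≢ Z eq = contradiction (List.∷ʳ-injectiveʳ (Vec.toList I′) Z
        (≡.trans (≡.sym (≡.trans (≡.cong Vec.toList eqc) (Vec.toList-∷ʳ false I′))) eq)) λ ()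

    private
      indicator-snoc-refl : ∀ {n} (L : Subset n) x X → X ≡ Vec.toList (L Vec.∷ʳ x) →
        indicator X (Vec.toList L ++ x ∷ []) ≈ 1#
      indicator-snoc-refl L x _ ≡.refl = trans
        (reflexive (≡.cong (indicator (Vec.toList (L Vec.∷ʳ x))) (≡.sym (Vec.toList-∷ʳ x L))))
        (indicator-refl (Vec.toList (L Vec.∷ʳ x)))

      indicator-snoc-≢ : ∀ c I x → J c ≢ I Vec.∷ʳ x → indicator (list c) (Vec.toList I ++ x ∷ []) ≈ 0#
      indicator-snoc-≢ c I x J≢ = indicator-≢ {list c} {Vec.toList I ++ x ∷ []} λ eq →
        J≢ (toList-injective (≡.trans eq (≡.sym (Vec.toList-∷ʳ x I))))

    T-inside-zero : ∀ r c {I} → J r ≡ inside Vec.∷ I → J c ≢ I Vec.∷ʳ inside → Q r c ≈ 0#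
    T-inside-zero r c {I} eq J≢ = trans (-‿cong (trans (T-inside r c eq)
      (*-zeroʳ (weight 0) (indicator-snoc-≢ c I inside J≢)))) -0#≈0#

    -- The choice `s = -b` when `I` contains `-b` and `s = a` otherwise; these entries of `T` are
    -- the diagonal of its block triangular form.
    rotate : Index → Index
    rotate (x Vec.∷ I) = I Vec.∷ʳ x

    rotate-injective : ∀ {I I′} → rotate I ≡ rotate I′ → I ≡ I′
    rotate-injective {x Vec.∷ I} {x′ Vec.∷ I′} eq =
      ≡.cong₂ Vec._∷_ (Vec.∷ʳ-injectiveʳ I I′ eq) (Vec.∷ʳ-injectiveˡ I I′ eq)

    ∣rotate∣ : ∀ I → ∣ rotate I ∣ ≡ ∣ I ∣
    ∣rotate∣ (x Vec.∷ I) = ∣∷ʳ∣ I x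

    σ : Fin (suc m) → Fin (suc m)
    σ r = proj₁ (J-surjective (rotate (J r)) (≡.trans (∣rotate∣ (J r)) (∣J∣ r)))

    J-σ : ∀ r → J (σ r) ≡ rotate (J r)
    J-σ r = proj₂ (J-surjective (rotate (J r)) (≡.trans (∣rotate∣ (J r)) (∣J∣ r)))

    σ-injective : Injective _≡_ _≡_ σ
    σ-injective {r} {s} eq = J-injective (rotate-injective
      (≡.trans (≡.sym (J-σ r)) (≡.trans (≡.cong J eq) (J-σ s))))

    negate-#0 : ∀ {x y} → y ≈ x → x # 0# → (~ y) # 0#
    negate-#0 {x} y≈x x#0 = #-congʳ (trans (-1*x≈-x x) (-‿cong (sym y≈x))) (x#0y#0→xy#0 -1#0 x#0)

    Q-rotate-#0 : ∀ r → Q r (σ r) # 0#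
    Q-rotate-#0 r = entry (J r) ≡.refl
      where
      list-σ : ∀ {x I} → J r ≡ x Vec.∷ I → list (σ r) ≡ Vec.toList (I Vec.∷ʳ x)
      list-σ eq = ≡.cong Vec.toList (≡.trans (J-σ r) (≡.cong rotate eq))

      entry : ∀ I → J r ≡ I → Q r (σ r) # 0#
      entry (inside Vec.∷ I)  eq = negate-#0 (trans (T-inside r (σ r) eq)
        (trans (*-congˡ (indicator-snoc-refl I inside (list (σ r)) (list-σ eq))) (*-identityʳ _))) w-bottom
      entry (outside Vec.∷ I) eq = negate-#0
        (trans (T-outside r (σ r) eq (≡.trans (J-σ r) (≡.cong rotate eq)))
          (*-congˡ (trans (*-congˡ (indicator-snoc-refl I outside (list (σ r)) (list-σ eq))) (*-identityʳ _))))
        (x#0y#0→xy#0 (sign#0 (size (Vec.toList I))) w-top)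

    -- Rows containing `-b` have one nonzero entry, and rotation maps them onto the columns
    -- containing `a - 1`. Any other row meets the remaining columns only at its own rotation, so
    -- each further nonzero entry lies in a column owned by a one-entry row.
    Q-off-rotate : ∀ r c → c ≢ σ r → Q r c ≈ 0# ⊎ ∃ λ k → σ k ≡ c × ZeroOutside (Q k) c
    Q-off-rotate r c c≢σr = entry (J r) ≡.refl
      where
      J≢ : ∀ {x I} → J r ≡ x Vec.∷ I → J c ≢ I Vec.∷ʳ x
      J≢ eq eq′ = c≢σr (J-injective (≡.trans eq′ (≡.sym (≡.trans (J-σ r) (≡.cong rotate eq)))))

      entry : ∀ I → J r ≡ I → Q r c ≈ 0# ⊎ ∃ λ k → σ k ≡ c × ZeroOutside (Q k) c
      entry (inside Vec.∷ I)  eq = inj₁ (T-inside-zero r c eq (J≢ eq))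
      entry (outside Vec.∷ I) eq = column (Vec.initLast (J c))
        where
        column : (∃ λ I′ → ∃ λ x → J c ≡ I′ Vec.∷ʳ x) → Q r c ≈ 0# ⊎ ∃ λ k → σ k ≡ c × ZeroOutside (Q k) c
        column (I′ , outside , eqc) = inj₁ (trans (-‿cong (trans (T-outside r c eq eqc)
          (*-zeroʳ (sign (size (Vec.toList I)))
            (*-zeroʳ (weight (b ℕ.+ a)) (indicator-snoc-≢ c I outside (J≢ eq)))))) -0#≈0#)
        column (I′ , inside , eqc) = inj₂ (k , σk≡c , λ c′ c′≢c →
          T-inside-zero k c′ J-k λ eq′ → c′≢c (J-injective (≡.trans eq′ (≡.sym eqc))))
          where
          preimage : ∃ λ k → J k ≡ inside Vec.∷ I′
          preimage = J-surjective (inside Vec.∷ I′)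
            (≡.trans (≡.sym (∣∷ʳ∣ I′ inside)) (≡.trans (≡.cong ∣_∣ (≡.sym eqc)) (∣J∣ c)))
          k = proj₁ preimage
          J-k = proj₂ preimage
          σk≡c : σ k ≡ c
          σk≡c = J-injective (≡.trans (J-σ k) (≡.trans (≡.cong rotate J-k) (≡.sym eqc)))

    detMʳ-#0 : Mz.det Mʳ 0 # 0#
    detMʳ-#0 = #-congʳ (sym (constantTerm-det Mʳ)) (det-#0 Q σ σ-injective Q-rotate-#0 Q-off-rotate)

    -- Shifted by one, with 0 in front, so that the constant coefficient obeys the same recursion as
    -- the others.
    reversedCofactor : ℕ → List Bool → Carrier
    reversedCofactor zero    L = 0#
    reversedCofactor (suc k) L = onLists (λ j → adjʳ j k) L

    private
      solve-for : ∀ {p t x} → p - t ≈ x → t ≈ p - x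
      solve-for {p} {t} {x} eq = begin
        t              ≈⟨ +-identityˡ t ⟨
        0# + t         ≈⟨ +-congʳ (-‿inverseʳ p) ⟨
        (p - p) + t    ≈⟨ +-assoc _ _ _ ⟩
        p + (~ p + t)  ≈⟨ +-congˡ (+-congˡ (-‿involutive t)) ⟨
        p + (~ p - ~ t) ≈⟨ +-congˡ (-‿+-comm _ _) ⟩
        p - (p - t)    ≈⟨ +-congˡ (-‿cong eq) ⟩
        p - x          ∎

    -- The coefficient of `z ^ k` in `(z - T) adjʳ = det Mʳ * e`, solved for the part with `T`.
    reversedCofactor-row : ∀ i k → sum (λ j → T (J i) (J j) * adjʳ j k) ≈
      reversedCofactor k (list i) - Mz.det Mʳ k * indicator I₀-list (list i)
    reversedCofactor-row i zero = trans
      (solve-for (trans (+-identityˡ _) (trans (sym (Q-sum i (λ j → adjʳ j 0))) (linear∙cofactor-zero Q P i))))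
      (+-congˡ (-‿cong (trans (*-comm _ _) (*-congˡ (basis≈indicator i)))))
    reversedCofactor-row i (suc k) = begin
      sum (λ j → T (J i) (J j) * adjʳ j (suc k))
        ≈⟨ solve-for (begin
             p - sum (λ j → T (J i) (J j) * adjʳ j (suc k))   ≈⟨ +-comm _ _ ⟩
             ~ sum (λ j → T (J i) (J j) * adjʳ j (suc k)) + p ≈⟨ +-congʳ (Q-sum i (λ j → adjʳ j (suc k))) ⟨
             sum (λ j → Q i j * adjʳ j (suc k)) + p           ≈⟨ linear∙cofactor-suc Q P i k ⟩
             basis i * Mz.det Mʳ (suc k)                      ∎) ⟩
      p - basis i * Mz.det Mʳ (suc k)
        ≈⟨ +-cong (trans (P-sum i (λ j → adjʳ j k)) (sym (onLists-list (λ j → adjʳ j k) i)))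
             (-‿cong (trans (*-comm _ _) (*-congˡ (basis≈indicator i)))) ⟩
      reversedCofactor (suc k) (list i) - Mz.det Mʳ (suc k) * indicator I₀-list (list i) ∎
      where
      p : Carrier
      p = sum (λ j → P i j * adjʳ j k)

    reversedCofactor-solves : ∀ k L → length L ≡ b ℕ.+ a → size L ≡ a →
      contract (L ++ true ∷ []) weight (shift (reversedCofactor (suc k))) ≈
      reversedCofactor k L - Mz.det Mʳ k * indicator I₀-list L
    reversedCofactor-solves k L len sz = at (list-surjective L (len , sz))
      where
      at : (∃ λ i → list i ≡ L) →
        contract (L ++ true ∷ []) weight (shift (reversedCofactor (suc k))) ≈
        reversedCofactor k L - Mz.det Mʳ k * indicator I₀-list L
      at (i , ≡.refl) = trans (sym (T-action i (λ j → adjʳ j k))) (reversedCofactor-row i k)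

    private
      reversedCofactor-I₀ : ∀ k → reversedCofactor (suc k) I₀-list ≈ Mz.det minor₀ʳ k
      reversedCofactor-I₀ k = trans
        (reflexive (≡.cong (onLists (λ j → adjʳ j k)) (≡.sym I₀-list≡)))
        (trans (onLists-list (λ j → adjʳ j k) zero) (adjʳ-zero k))

      -- This is `a + b - 1`; the 1 undoes the index shift of `reversedCofactor`.
      order : ℕ
      order = a′ ℕ.+ b

    minor₀ʳ-low : ∀ k → k ℕ.< order → Mz.det minor₀ʳ k ≈ 0#
    minor₀ʳ-low k k<order = trans (sym (reversedCofactor-I₀ k))
      (Reversed.low-coefficients K weight a′ b′ w-bottom w-top reversedCofactor (Mz.det Mʳ)
        (λ _ → refl) detMʳ-#0 reversedCofactor-solves (suc k) (s≤s k<order))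

    minor₀ʳ-order : Mz.det minor₀ʳ order # 0#
    minor₀ʳ-order = #-congʳ (reversedCofactor-I₀ order)
      (Reversed.lowest-coefficient K weight a′ b′ w-bottom w-top reversedCofactor (Mz.det Mʳ)
        (λ _ → refl) detMʳ-#0 reversedCofactor-solves)

    size≡C : suc m ≡ (a ℕ.+ b) C a
    size≡C = ≡.trans (≡.cong length (≡.sym indices≡))
      (≡.trans (length-subsetsOfSize (b ℕ.+ a) a) (≡.cong (_C a) (ℕ.+-comm b a)))

    D-degree : HasDegree K D ((a ℕ.+ b) C a)
    D-degree = ≡.subst (HasDegree K D) size≡C
      ( #-congʳ (sym (trans (D≈ (suc m)) (proj₁ rev (suc m) 0 (ℕ.+-identityʳ (suc m))))) detMʳ-#0
      , λ n m<n → trans (D≈ n) (proj₁ (proj₂ rev) n m<n))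
      where rev = det-reversal P Q

    -- The minor has size `m = C(a+b, a) - 1`, and its reversal starts at `z ^ (a + b - 1)`; the two
    -- units cancel in the difference.
    N-degree : HasDegree K N ((a ℕ.+ b) C a ℕ.∸ a ℕ.∸ b)
    N-degree = ≡.subst (HasDegree K N) degree≡
      ( #-congʳ (sym (trans (N≈ (m ℕ.∸ order)) (proj₁ rev (m ℕ.∸ order) order (ℕ.m∸n+n≡m order≤m)))) minor₀ʳ-order
      , λ n lt → trans (N≈ n) (above n lt))
      where
      rev : Reversal m (Mz.det minor₀) (Mz.det minor₀ʳ)
      rev = det-reversal (λ r c → P (suc r) (suc c)) (λ r c → Q (suc r) (suc c))

      degree≡ : m ℕ.∸ order ≡ (a ℕ.+ b) C a ℕ.∸ a ℕ.∸ b
      degree≡ = ≡.trans (≡.sym (ℕ.∸-+-assoc m a′ b)) (≡.cong (λ d → d ℕ.∸ a ℕ.∸ b) size≡C)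

      order≤m : order ℕ.≤ m
      -- A nonzero coefficient of the reversed minor cannot lie above its size. Hence the truncated
      -- subtraction in the degree is a true one.
      order≤m = ℕ.≮⇒≥ λ m<order → HeytingField.#-irrefl K (proj₂ (proj₂ rev) order m<order) minor₀ʳ-order

      above : ∀ n → m ℕ.∸ order ℕ.< n → Mz.det minor₀ n ≈ 0#
      above n lt with n ℕ.≤? m
      ... | no n≰m  = proj₁ (proj₂ rev) n (ℕ.≰⇒> n≰m)
      ... | yes n≤m = trans (proj₁ rev n (m ℕ.∸ n) (ℕ.m+[n∸m]≡n n≤m))
        (minor₀ʳ-low (m ℕ.∸ n) (≡.subst (m ℕ.∸ n ℕ.<_) (ℕ.m∸[m∸n]≡n order≤m) (ℕ.∸-monoʳ-< lt n≤m)))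

  -- At `z = 0` the matrix `1 - zT` is the identity `P`.
  detM-#0 : Mz.det M 0 # 0#
  detM-#0 = #-congʳ (sym (constantTerm-det M)) (det-#0 P (λ i → i) (λ eq → eq)
    (λ i → #-congʳ (sym (P-diagonal i)) 1#0)
    (λ i j j≢i → inj₁ (P-offDiagonal i j j≢i)))

  D-invertible : Invertible S._≈_ S.1# S._*_ D
  D-invertible = invertible-#0 K D (#-congʳ {Mz.det M 0} {D 0} (sym (D≈ 0)) detM-#0)

-- Band structure of the weights from the extremes of `S`.

module WeightsOf {c ℓ₁ ℓ₂} (K : HeytingField c ℓ₁ ℓ₂) (S : List ℤ) (a′ b′ : ℕ)
  (≤a : All.All (ℤ._≤ + suc a′) S) (-b≤ : All.All (ℤ.-[1+ b′ ] ℤ.≤_) S)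
  (ω : ℤ → HeytingField.Carrier K) (ω≈0 : ∀ s → s ∉ S → HeytingField._≈_ K (ω s) (HeytingField.0# K))
  (ω-a#0 : HeytingField._#_ K (ω (+ suc a′)) (HeytingField.0# K))
  (ω-b#0 : HeytingField._#_ K (ω ℤ.-[1+ b′ ]) (HeytingField.0# K)) where
  open Main K ω a′ b′
  open FieldDeterminants K
  open CommutativeRing commRing hiding (zero; -_)
  open RingProperties ring
  open HeytingField K using (_#_)
  open FormalPowerSeries commRing
  open Weighted K ω a b
  open Transfer K ω a b using (weight)
  open CommutativeSemigroupProperties SR.*-commutativeSemigroup using (xy∙z≈xz∙y)

  β-outside : ∀ s → s ≢ + 0 → s ∉ S → β s ≈ 0#
  β-outside s s≢0 s∉S = trans (+-cong (reflexive (≡.cong (λ d → if d then 1# else 0#) (dec-false (s ℤ.≟ + 0) s≢0)))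
    (trans (-‿cong (ω≈0 s s∉S)) -0#≈0#)) (+-identityˡ 0#)

  β-#0 : ∀ s → s ≢ + 0 → ω s # 0# → β s # 0#
  β-#0 s s≢0 ω#0 = #-congʳ (sym (trans
      (trans (+-congʳ (reflexive (≡.cong (λ d → if d then 1# else 0#) (dec-false (s ℤ.≟ + 0) s≢0)))) (+-identityˡ _))
      (sym (-1*x≈-x (ω s)))))
    (x#0y#0→xy#0 -1#0 ω#0)

  ⊖b : ∀ x → (b ℕ.+ x) ⊖ b ≡ + x
  ⊖b x = ≡.trans (≡.cong ((b ℕ.+ x) ⊖_) (≡.sym (ℕ.+-identityʳ b))) (ℤ.+-cancelˡ-⊖ b x 0)

  -- The argument is `a + 1 + i`: above every element of `S`, and not 0, where `δ` would contribute.
  β-high : ∀ i → β ((suc (b ℕ.+ a) ℕ.+ i) ⊖ b) ≈ 0#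
  β-high i = trans
    (reflexive (≡.cong β (≡.trans (≡.cong (_⊖ b) (≡.trans (≡.cong suc (ℕ.+-assoc b a i)) (≡.sym (ℕ.+-suc b (a ℕ.+ i)))))
      (⊖b (suc (a ℕ.+ i))))))
    (β-outside (+ suc (a ℕ.+ i)) (λ ()) λ s∈S →
      ℕ.1+n≰n (ℕ.≤-trans (s≤s (ℕ.m≤m+n a i)) (ℤ.drop‿+≤+ (All.lookup ≤a s∈S))))

  β-low : ∀ r → β (0 ⊖ suc (r ℕ.+ b)) ≈ 0#
  β-low r = β-outside ℤ.-[1+ r ℕ.+ b ] (λ ()) λ s∈S →
    ℕ.1+n≰n (ℕ.≤-trans (ℕ.m≤n+m b r) (ℤ.drop‿-≤- (All.lookup -b≤ s∈S)))

  w-bottom : weight 0 # 0#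
  w-bottom = β-#0 ℤ.-[1+ b′ ] (λ ()) ω-b#0

  w-top : weight (b ℕ.+ a) # 0#
  w-top = #-congʳ (reflexive (≡.cong β (≡.sym (⊖b a)))) (β-#0 (+ a) (λ ()) ω-a#0)

  F≈N*D⁻¹ : F SR.≈ (N SR.* proj₁ D-invertible)
  F≈N*D⁻¹ = SR.sym (SR.trans (SR.*-congʳ (N≈D*F β-high β-low))
    (SR.trans (xy∙z≈xz∙y D F (proj₁ D-invertible))
    (SR.trans (SR.*-congʳ (proj₂ (proj₂ D-invertible))) (SR.*-identityˡ F))))

open import Data.Integer.Base using (-_)
open import Data.Nat.Base using (_+_; _∸_; _≤_)

mainTheorem5 :
  ∀ {c ℓ₁ ℓ₂} (K : HeytingField c ℓ₁ ℓ₂) →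
  let module K = HeytingField K in
  CharacteristicZero K →
  (S : List ℤ) (a b : ℕ) →
  IsMaxOf (+ a) S → 1 ≤ a →
  IsMinOf (- (+ b)) S → 1 ≤ b →
  (ω : ℤ → K.Carrier) → (∀ s → s ∉ S → ω s K.≈ K.0#) →
  ω (+ a) K.# K.0# → ω (- (+ b)) K.# K.0# →
  let open Weighted K ω a b in
  Σ (Invertible K[[z]]._≈_ K[[z]].1# K[[z]]._*_ D) (λ D⁻¹ → F K[[z]].≈ (N K[[z]].* proj₁ D⁻¹))
  × HasDegree K D ((a + b) C a)
  × HasDegree K N ((a + b) C a ∸ a ∸ b)
mainTheorem5 K _ S (suc a′) (suc b′) (_ , ≤a) _ (_ , -b≤) _ ω ω≈0 ω-a#0 ω-b#0 =
  (D-invertible , F≈N*D⁻¹) , D-degree w-bottom w-top , N-degree w-bottom w-top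
  where
  open Main K ω a′ b′
  open WeightsOf K S a′ b′ ≤a -b≤ ω ω≈0 ω-a#0 ω-b#0
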